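{- Let $d\ge1$ and $1\le r\le d$ be integers. There exist constants $C>0$ and $n_0$ (depending only on $d$ and $r$) such that for all odd integers $n\ge n_0$, $$\overleftarrow{m}(\mathbb{T}_n^d,r)\le\frac{1}{r}\binom{d}{r-1}n^{r-1}+Cn^{r-2}.$$
   Context: The $d$-dimensional torus $\mathbb{T}_n^d$ is the graph with vertex set $[n]^d=\{1,\dots,n\}^d$, where two vertices are adjacent iff they differ in exactly one coordinate $j$ and in that coordinate $x_j-x'_j\equiv\pm1\pmod n$. A configuration assigns each vertex a state active (1) or inactive (0); its size is the number of active vertices. In reversible $r$-bootstrap percolation, in each round, simultaneously, every vertex becomes active if it has at least $r$ active neighbors and inactive otherwise. A dynamo is an initial configuration such that from some time on all vertices are active in all subsequent rounds. $\overleftarrow{m}(G,r)$ is the minimum size of a dynamo under reversible $r$-bootstrap percolation on $G$. -}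

module Defs where

open import Data.Bool using (Bool; true; false; _∧_; _∨_; not; if_then_else_)
open import Data.Nat using (ℕ; zero; suc; _+_; _*_; _≤_; _≤ᵇ_; _≡ᵇ_)
open import Data.Fin using (Fin; toℕ)
open import Data.Vec using (Vec; []; _∷_)
open import Data.List using (List; []; _∷_; map; concatMap)
open import Data.List using (allFin)
open import Data.Nat.ListAction using (sum)
open import Data.Product using (Σ; _×_)
open import Relation.Binary.PropositionalEquality using (_≡_)
open import Data.Fin using (_≟_)
open import Relation.Nullary.Decidable using (⌊_⌋)
open import Function using (_∘_)

Odd : ℕ → Set
Odd n = Σ ℕ (λ k → n ≡ suc (2 * k))

Vertex : ℕ → ℕ → Set
Vertex d n = Vec (Fin n) d

allFinList : (n : ℕ) → List (Fin n)
allFinList n = allFin n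

vertices : (d n : ℕ) → List (Vertex d n)
vertices zero n = [] ∷ []
vertices (suc d) n =
  concatMap (λ a → map (a ∷_) (vertices d n)) (allFinList n)

eqF : {n : ℕ} → Fin n → Fin n → Bool
eqF a b = ⌊ a ≟ b ⌋

eqV : {d n : ℕ} → Vertex d n → Vertex d n → Bool
eqV [] [] = true
eqV (a ∷ as) (b ∷ bs) = eqF a b ∧ eqV as bs

-- a and b are distinct and a - b ≡ ±1 (mod n)
pm1 : (n : ℕ) → Fin n → Fin n → Bool
pm1 n a b = not (eqF a b) ∧
  ((suc (toℕ a) ≡ᵇ toℕ b) ∨ (suc (toℕ b) ≡ᵇ toℕ a)
   ∨ ((suc (toℕ a) ≡ᵇ n) ∧ (toℕ b ≡ᵇ 0))
   ∨ ((suc (toℕ b) ≡ᵇ n) ∧ (toℕ a ≡ᵇ 0)))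

adj : {d n : ℕ} → Vertex d n → Vertex d n → Bool
adj [] [] = false
adj {n = n} (a ∷ as) (b ∷ bs) =
  (pm1 n a b ∧ eqV as bs) ∨ (eqF a b ∧ adj as bs)

-- configurations: true = active, false = inactive
Config : ℕ → ℕ → Set
Config d n = Vertex d n → Bool

indicator : Bool → ℕ
indicator b = if b then 1 else 0

size : {d n : ℕ} → Config d n → ℕ
size {d} {n} c = sum (map (indicator ∘ c) (vertices d n))

activeNbrs : {d n : ℕ} → Config d n → Vertex d n → ℕ
activeNbrs {d} {n} c x =
  sum (map (λ y → indicator (adj x y ∧ c y)) (vertices d n))

step : {d n : ℕ} → ℕ → Config d n → Config d n
step r c x = r ≤ᵇ activeNbrs c x

run : {d n : ℕ} → ℕ → ℕ → Config d n → Config d n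
run r zero c = c
run r (suc t) c = step r (run r t c)

IsDynamo : (d n r : ℕ) → Config d n → Set
IsDynamo d n r c =
  Σ ℕ (λ T → (t : ℕ) → T ≤ t → (x : Vertex d n) → run r t c x ≡ true)

IsMinDynamoSize : (d n r m : ℕ) → Set
IsMinDynamoSize d n r m =
  Σ (Config d n) (λ c → IsDynamo d n r c × size c ≡ m)
  × ((c : Config d n) → IsDynamo d n r c → m ≤ size c)

{-# OPTIONS --safe #-}
module Submission where

open import Defs
open import Data.Nat using (ℕ; _+_; _*_; _^_; _∸_; _≤_)
open import Data.Nat.Combinatorics using (_C_)
open import Data.Product using (Σ; _×_)
open import Algebra.Properties.CommutativeSemigroup using (interchange; x∙yz≈y∙xz)
open import Data.Bool using (Bool; true; false; _∧_; _∨_; not)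
import Data.Bool as Bool
open import Data.Bool.Properties using (T-≡; ∨-zeroʳ; ∧-assoc; not-involutive)
open import Data.Empty using (⊥; ⊥-elim)
open import Data.Fin using (Fin; zero; suc; toℕ; fromℕ; inject₁; _≟_; finToFun; funToFin)
open import Data.Fin.Properties using (toℕ-fromℕ; toℕ-inject₁; toℕ<n; pigeonhole; all?; any?; finToFun-funToFin)
open import Data.Fin.Relation.Unary.Top using (view; ‵fromℕ; ‵inject₁)
open import Data.List using (List; []; _∷_; map; concatMap; tabulate; _++_)
open import Data.List.Properties using (map-++; map-∘)
open import Data.Nat as ℕ using (zero; suc; _<_; _≤ᵇ_; _≡ᵇ_; z≤n; s≤s; _≤?_; _<?_)
open import Data.Nat.Combinatorics using (nCk+nC[k+1]≡[n+1]C[k+1]; nCn≡1; nCk≡nC[n∸k])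
open import Data.Nat.ListAction using (sum)
open import Data.Nat.ListAction.Properties using (sum-++)
open import Data.Nat.Properties hiding (_≟_)
open import Data.Nat.Solver using (module +-*-Solver)
open import Data.Product using (_,_; proj₁; proj₂; ∃)
open import Data.Sum using (_⊎_; inj₁; inj₂)
open import Data.Vec as Vec using ([]; _∷_; lookup; _[_]≔_)
import Data.Vec.Properties as Vec
open import Function using (_∘_; Equivalence; id)
open import Relation.Binary.Definitions using (tri<; tri≈; tri>)
open import Relation.Binary.PropositionalEquality
open import Relation.Nullary using (Dec; yes; no)
open import Relation.Nullary.Decidable using (map′; _×-dec_)

-- Put s = r − 1.  Pair a vertex x with a time t; as n is odd, the parity of t + Σ x is preserved by the
-- steps that do not wrap around and reversed by those that do, so the process runs on the bipartite double
-- cover, and an initial configuration only has to conquer the sheet where t + Σ x is even.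
--
-- Vertices with fewer than s coordinates outside {0,1} are all active initially (O(n^(s-1)) of them); each
-- has a neighbour of the same kind in every direction, so they stay active.  In a flat of vertices with
-- given support of size s, leave out the first coordinate of the support, sum the others modulo r, and
-- activate the even vertices of the layers 0 and 1.  Each vertex of this strip has 2 + (s − 1) = r
-- neighbours in it, so the strip sustains itself; its density is 2 / r, and taking one parity
-- only leaves about n^s / r active vertices in each of the (d choose s) flats.
-- On layer j + 1 ≥ 2, a vertex becomes active after its neighbours below in directions 0 and k ≥ j
-- and above in directions 1 ≤ k ≤ j: these are r neighbours, and all of them are smaller for the order given
-- by Σₖ (2k + 1) xₖ − j (j + 1).  Once the flats are full, the even sheet fills up from the corner 0 by
-- induction on Σ x, and then the odd sheet, where a vertex with support of size s < d gets its
-- r-th active neighbour by wrapping around a zero coordinate.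

-- Finite sums over `Fin n`.

∑ : ∀ {n} → (Fin n → ℕ) → ℕ
∑ {zero}  f = 0
∑ {suc n} f = f zero + ∑ (f ∘ suc)

∑-cong : ∀ {n} {f g : Fin n → ℕ} → f ≗ g → ∑ f ≡ ∑ g
∑-cong {zero}  e = refl
∑-cong {suc n} e = cong₂ _+_ (e zero) (∑-cong (e ∘ suc))

∑-mono-≤ : ∀ {n} {f g : Fin n → ℕ} → (∀ i → f i ≤ g i) → ∑ f ≤ ∑ g
∑-mono-≤ {zero}  p = z≤n
∑-mono-≤ {suc n} p = +-mono-≤ (p zero) (∑-mono-≤ (p ∘ suc))

∑-mono-< : ∀ {n} {f g : Fin n → ℕ} (i : Fin n) → f i < g i → (∀ j → f j ≤ g j) → ∑ f < ∑ g
∑-mono-< zero    f<g p = +-mono-<-≤ f<g (∑-mono-≤ (p ∘ suc))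
∑-mono-< (suc i) f<g p = +-mono-≤-< (p zero) (∑-mono-< i f<g (p ∘ suc))

∑-const : ∀ n k → ∑ {n} (λ _ → k) ≡ n * k
∑-const zero    k = refl
∑-const (suc n) k = cong (k +_) (∑-const n k)

∑-zero : ∀ n → ∑ {n} (λ _ → 0) ≡ 0
∑-zero n = trans (∑-const n 0) (*-zeroʳ n)

∑-+ : ∀ {n} (f g : Fin n → ℕ) → ∑ (λ i → f i + g i) ≡ ∑ f + ∑ g
∑-+ {zero}  f g = refl
∑-+ {suc n} f g =
  trans (cong (f zero + g zero +_) (∑-+ (f ∘ suc) (g ∘ suc)))
        (interchange +-commutativeSemigroup (f zero) (g zero) (∑ (f ∘ suc)) (∑ (g ∘ suc)))

∑-*ʳ : ∀ {n} (f : Fin n → ℕ) k → ∑ (λ i → f i * k) ≡ ∑ f * k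
∑-*ʳ {zero}  f k = refl
∑-*ʳ {suc n} f k =
  trans (cong (f zero * k +_) (∑-*ʳ (f ∘ suc) k)) (sym (*-distribʳ-+ k (f zero) _))

∑-*ˡ : ∀ {n} k (f : Fin n → ℕ) → ∑ (λ i → k * f i) ≡ k * ∑ f
∑-*ˡ {zero}  k f = sym (*-zeroʳ k)
∑-*ˡ {suc n} k f =
  trans (cong (k * f zero +_) (∑-*ˡ k (f ∘ suc))) (sym (*-distribˡ-+ k (f zero) _))

≤-∑ : ∀ {n} (f : Fin n → ℕ) i → f i ≤ ∑ f
≤-∑ f zero    = m≤m+n _ _
≤-∑ f (suc i) = ≤-trans (≤-∑ (f ∘ suc) i) (m≤n+m _ _)

≤-∑₂ : ∀ {n} (f : Fin n → ℕ) {i j} → i ≢ j → f i + f j ≤ ∑ f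
≤-∑₂ f {zero}  {zero}  i≢j = ⊥-elim (i≢j refl)
≤-∑₂ f {zero}  {suc j} i≢j = +-monoʳ-≤ (f zero) (≤-∑ (f ∘ suc) j)
≤-∑₂ f {suc i} {zero}  i≢j =
  ≤-trans (≤-reflexive (+-comm _ (f zero))) (+-monoʳ-≤ (f zero) (≤-∑ (f ∘ suc) i))
≤-∑₂ f {suc i} {suc j} i≢j = ≤-trans (≤-∑₂ (f ∘ suc) (i≢j ∘ cong suc)) (m≤n+m _ _)

-- Applied to three distinct values of one coordinate: a value and its two cyclic neighbours.
≤-∑₃ : ∀ {n} (f : Fin n → ℕ) {i j k} → i ≢ j → i ≢ k → j ≢ k → (f i + f j) + f k ≤ ∑ f
≤-∑₃ f {zero}  {zero}  {k}     p q r = ⊥-elim (p refl)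
≤-∑₃ f {zero}  {suc j} {zero}  p q r = ⊥-elim (q refl)
≤-∑₃ f {suc i} {zero}  {zero}  p q r = ⊥-elim (r refl)
≤-∑₃ f {zero}  {suc j} {suc k} p q r =
  ≤-trans (≤-reflexive (+-assoc (f zero) _ _)) (+-monoʳ-≤ (f zero) (≤-∑₂ (f ∘ suc) (r ∘ cong suc)))
≤-∑₃ f {suc i} {zero}  {suc k} p q r =
  ≤-trans (≤-reflexive (trans (cong (_+ f (suc k)) (+-comm _ (f zero))) (+-assoc (f zero) _ _)))
          (+-monoʳ-≤ (f zero) (≤-∑₂ (f ∘ suc) (q ∘ cong suc)))
≤-∑₃ f {suc i} {suc j} {zero}  p q r =
  ≤-trans (≤-reflexive (+-comm _ (f zero))) (+-monoʳ-≤ (f zero) (≤-∑₂ (f ∘ suc) (p ∘ cong suc)))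
≤-∑₃ f {suc i} {suc j} {suc k} p q r =
  ≤-trans (≤-∑₃ (f ∘ suc) (p ∘ cong suc) (q ∘ cong suc) (r ∘ cong suc)) (m≤n+m _ _)

-- Sums over the vertices of the torus.

∑ᵥ : ∀ {d n} → (Vertex d n → ℕ) → ℕ
∑ᵥ {d} {n} h = sum (map h (vertices d n))

sum-concatMap : ∀ {A B : Set} (h : B → ℕ) (k : A → List B) (l : List A) →
  sum (map h (concatMap k l)) ≡ sum (map (λ a → sum (map h (k a))) l)
sum-concatMap h k []      = refl
sum-concatMap h k (a ∷ l) = begin
  sum (map h (k a ++ concatMap k l))              ≡⟨ cong sum (map-++ h (k a) _) ⟩
  sum (map h (k a) ++ map h (concatMap k l))      ≡⟨ sum-++ (map h (k a)) _ ⟩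
  sum (map h (k a)) + sum (map h (concatMap k l)) ≡⟨ cong (sum (map h (k a)) +_) (sum-concatMap h k l) ⟩
  sum (map h (k a)) + sum (map (λ b → sum (map h (k b))) l) ∎
  where open ≡-Reasoning

sum-tabulate : ∀ {A : Set} {n} (h : A → ℕ) (f : Fin n → A) → sum (map h (tabulate f)) ≡ ∑ (h ∘ f)
sum-tabulate {n = zero}  h f = refl
sum-tabulate {n = suc n} h f = cong (h (f zero) +_) (sum-tabulate h (f ∘ suc))

∑ᵥ-∷ : ∀ {d n} (h : Vertex (suc d) n → ℕ) → ∑ᵥ h ≡ ∑ (λ a → ∑ᵥ (h ∘ (a ∷_)))
∑ᵥ-∷ {d} {n} h = begin
  sum (map h (concatMap (λ a → map (a ∷_) (vertices d n)) (allFinList n)))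
    ≡⟨ sum-concatMap h _ (allFinList n) ⟩
  sum (map (λ a → sum (map h (map (a ∷_) (vertices d n)))) (allFinList n))
    ≡⟨ sum-tabulate {n = n} _ id ⟩
  ∑ (λ a → sum (map h (map (a ∷_) (vertices d n))))
    ≡⟨ ∑-cong {n} (λ a → cong sum (sym (map-∘ {g = h} {f = a ∷_} (vertices d n)))) ⟩
  ∑ (λ a → ∑ᵥ (h ∘ (a ∷_))) ∎
  where open ≡-Reasoning

∑ᵥ-mono-≤ : ∀ {d n} {f g : Vertex d n → ℕ} → (∀ x → f x ≤ g x) → ∑ᵥ f ≤ ∑ᵥ g
∑ᵥ-mono-≤ {zero}  p = +-monoˡ-≤ 0 (p [])
∑ᵥ-mono-≤ {suc d} {f = f} {g} p =
  subst₂ _≤_ (sym (∑ᵥ-∷ f)) (sym (∑ᵥ-∷ g)) (∑-mono-≤ (λ a → ∑ᵥ-mono-≤ (p ∘ (a ∷_))))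

∑ᵥ-cong : ∀ {d n} {f g : Vertex d n → ℕ} → f ≗ g → ∑ᵥ f ≡ ∑ᵥ g
∑ᵥ-cong e = ≤-antisym (∑ᵥ-mono-≤ (≤-reflexive ∘ e)) (∑ᵥ-mono-≤ (≤-reflexive ∘ sym ∘ e))

∑ᵥ-+ : ∀ {d n} (f g : Vertex d n → ℕ) → ∑ᵥ (λ x → f x + g x) ≡ ∑ᵥ f + ∑ᵥ g
∑ᵥ-+ {zero}  f g = interchange +-commutativeSemigroup (f []) (g []) 0 0
∑ᵥ-+ {suc d} f g = begin
  ∑ᵥ (λ x → f x + g x)                          ≡⟨ ∑ᵥ-∷ (λ x → f x + g x) ⟩
  ∑ (λ a → ∑ᵥ (λ x → f (a ∷ x) + g (a ∷ x)))    ≡⟨ ∑-cong (λ a → ∑ᵥ-+ (f ∘ (a ∷_)) (g ∘ (a ∷_))) ⟩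
  ∑ (λ a → ∑ᵥ (f ∘ (a ∷_)) + ∑ᵥ (g ∘ (a ∷_)))   ≡⟨ ∑-+ _ (λ a → ∑ᵥ (g ∘ (a ∷_))) ⟩
  ∑ (λ a → ∑ᵥ (f ∘ (a ∷_))) + ∑ (λ a → ∑ᵥ (g ∘ (a ∷_)))
    ≡⟨ cong₂ _+_ (sym (∑ᵥ-∷ f)) (sym (∑ᵥ-∷ g)) ⟩
  ∑ᵥ f + ∑ᵥ g ∎
  where open ≡-Reasoning

∑ᵥ-zero : ∀ d n → ∑ᵥ {d} {n} (λ _ → 0) ≡ 0
∑ᵥ-zero zero    n = refl
∑ᵥ-zero (suc d) n =
  trans (∑ᵥ-∷ {d} {n} (λ _ → 0)) (trans (∑-cong {n} (λ _ → ∑ᵥ-zero d n)) (∑-zero n))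

∑-∑ᵥ : ∀ {d n k} (f : Fin k → Vertex d n → ℕ) → ∑ (λ a → ∑ᵥ (f a)) ≡ ∑ᵥ (λ x → ∑ (λ a → f a x))
∑-∑ᵥ {d} {n} {zero} f = sym (∑ᵥ-zero d n)
∑-∑ᵥ {k = suc k}    f =
  trans (cong (∑ᵥ (f zero) +_) (∑-∑ᵥ (f ∘ suc))) (sym (∑ᵥ-+ (f zero) (λ x → ∑ (λ a → f (suc a) x))))

≤-∑ᵥ : ∀ {d n} (h : Vertex d n → ℕ) x → h x ≤ ∑ᵥ h
≤-∑ᵥ h []      = m≤m+n _ _
≤-∑ᵥ h (a ∷ x) =
  ≤-trans (≤-trans (≤-∑ᵥ (h ∘ (a ∷_)) x) (≤-∑ (λ b → ∑ᵥ (h ∘ (b ∷_))) a)) (≤-reflexive (sym (∑ᵥ-∷ h)))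

-- Neighbours on the torus, direction by direction.

eqV-refl : ∀ {d n} (x : Vertex d n) → eqV x x ≡ true
eqV-refl []      = refl
eqV-refl (a ∷ x) with a ≟ a
... | yes _ = eqV-refl x
... | no ¬p = ⊥-elim (¬p refl)

eqF-refl : ∀ {n} (a : Fin n) → eqF a a ≡ true
eqF-refl a with a ≟ a
... | yes _ = refl
... | no ¬p = ⊥-elim (¬p refl)

eqF-≢ : ∀ {n} {a b : Fin n} → a ≢ b → eqF a b ≡ false
eqF-≢ {a = a} {b} a≢b with a ≟ b
... | yes p = ⊥-elim (a≢b p)
... | no _  = refl

≡ᵇ-refl : ∀ k → (k ≡ᵇ k) ≡ true
≡ᵇ-refl k = Equivalence.to T-≡ (≡⇒≡ᵇ k k refl)

dn : ∀ {m} → Fin (suc m) → Fin (suc m)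
dn {m} zero = fromℕ m
dn (suc a)  = inject₁ a

up : ∀ {m} → Fin (suc m) → Fin (suc m)
up a with view a
... | ‵fromℕ     = zero
... | ‵inject₁ b = suc b

up-cases : ∀ {m} (a : Fin (suc m)) → (up a ≡ zero × toℕ a ≡ m) ⊎ toℕ (up a) ≡ suc (toℕ a)
up-cases {m} a with view a
... | ‵fromℕ     = inj₁ (refl , toℕ-fromℕ m)
... | ‵inject₁ b = inj₂ (cong suc (sym (toℕ-inject₁ b)))

contribution : ∀ {d m} → Config d (suc m) → Vertex d (suc m) → Fin d → ℕ
contribution c x i = indicator (c (x [ i ]≔ up (lookup x i))) + indicator (c (x [ i ]≔ dn (lookup x i)))

module _ {m : ℕ} (2≤m : 2 ≤ m) where

  a≢dn : (a : Fin (suc m)) → a ≢ dn a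
  a≢dn zero    e = <⇒≢ (≤-trans (s≤s z≤n) 2≤m) (trans (cong toℕ e) (toℕ-fromℕ m))
  a≢dn (suc a) e = 1+n≢n (trans (cong toℕ e) (toℕ-inject₁ a))

  a≢up : (a : Fin (suc m)) → a ≢ up a
  a≢up a e with up-cases a
  ... | inj₁ (u , v) = <⇒≢ (≤-trans (s≤s z≤n) 2≤m) (trans (cong toℕ (sym (trans e u))) v)
  ... | inj₂ u       = 1+n≢n (trans (sym u) (cong toℕ (sym e)))

  up≢dn : (a : Fin (suc m)) → up a ≢ dn a
  up≢dn zero e with up-cases (zero {m})
  ... | inj₁ (u , v) = <⇒≢ (≤-trans (s≤s z≤n) 2≤m) v
  ... | inj₂ u       = <⇒≢ 2≤m (trans (sym u) (trans (cong toℕ e) (toℕ-fromℕ m)))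
  up≢dn (suc a) e with up-cases (suc a)
  ... | inj₁ (u , v) =
    <⇒≢ 2≤m (trans (cong suc (trans (cong toℕ (trans (sym u) e)) (toℕ-inject₁ a))) v)
  ... | inj₂ u       =
    m≢1+n+m (toℕ a) (trans (sym (toℕ-inject₁ a)) (trans (cong toℕ (sym e)) u))

  pm1-dn : (a : Fin (suc m)) → pm1 (suc m) a (dn a) ≡ true
  pm1-dn zero rewrite eqF-≢ (a≢dn zero) | toℕ-fromℕ m | ≡ᵇ-refl m
    = trans (cong ((1 ≡ᵇ m) ∨_) (∨-zeroʳ _)) (∨-zeroʳ (1 ≡ᵇ m))
  pm1-dn (suc a) rewrite eqF-≢ (a≢dn (suc a)) | toℕ-inject₁ a | ≡ᵇ-refl (toℕ a)
    = ∨-zeroʳ (suc (suc (toℕ a)) ≡ᵇ toℕ a)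

  pm1-up : (a : Fin (suc m)) → pm1 (suc m) a (up a) ≡ true
  pm1-up a with up-cases a
  ... | inj₁ (u , v) rewrite eqF-≢ (a≢up a) | u | v | ≡ᵇ-refl m = ∨-zeroʳ (1 ≡ᵇ m)
  ... | inj₂ u rewrite eqF-≢ (a≢up a) | u | ≡ᵇ-refl (toℕ a) = refl

  -- Neighbours of `a ∷ x` lie over `up a` and `dn a` with the same tail, or over `a` itself, where
  -- induction applies. For `2 ≤ m` these three values are distinct, so nothing is counted twice.
  ∑-contribution≤activeNbrs : ∀ {d} (c : Config d (suc m)) x → ∑ (contribution c x) ≤ activeNbrs c x
  ∑-contribution≤activeNbrs c []      = z≤n
  ∑-contribution≤activeNbrs {suc d} c (a ∷ x) = begin
    (indicator (c (up a ∷ x)) + indicator (c (dn a ∷ x))) + ∑ (contribution (c ∘ (a ∷_)) x)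
      ≤⟨ +-mono-≤ (+-mono-≤ (column (up a) (pm1-up a)) (column (dn a) (pm1-dn a))) fibre ⟩
    (h (up a) + h (dn a)) + h a
      ≤⟨ ≤-∑₃ h (up≢dn a) (a≢up a ∘ sym) (a≢dn a ∘ sym) ⟩
    ∑ h
      ≡⟨ sym (∑ᵥ-∷ g) ⟩
    activeNbrs c (a ∷ x) ∎
    where
    open ≤-Reasoning
    g : Vertex (suc d) (suc m) → ℕ
    g y = indicator (adj (a ∷ x) y ∧ c y)
    h : Fin (suc m) → ℕ
    h b = ∑ᵥ (g ∘ (b ∷_))
    column : ∀ b → pm1 (suc m) a b ≡ true → indicator (c (b ∷ x)) ≤ h b
    column b p = ≤-trans (≤-reflexive (cong indicator eq)) (≤-∑ᵥ (g ∘ (b ∷_)) x)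
      where
      eq : c (b ∷ x) ≡ adj (a ∷ x) (b ∷ x) ∧ c (b ∷ x)
      eq rewrite p | eqV-refl x = refl
    fibre : ∑ (contribution (c ∘ (a ∷_)) x) ≤ h a
    fibre = ≤-trans (∑-contribution≤activeNbrs (c ∘ (a ∷_)) x) (≤-reflexive (∑ᵥ-cong eq))
      where
      eq : ∀ y → indicator (adj x y ∧ c (a ∷ y)) ≡ g (a ∷ y)
      eq y rewrite eqF-refl a = refl

  step-active : ∀ {d r} (c : Config d (suc m)) x → r ≤ ∑ (contribution c x) → step r c x ≡ true
  step-active c x p = Equivalence.to T-≡ (≤⇒≤ᵇ (≤-trans p (∑-contribution≤activeNbrs c x)))

-- Parity, supports, ranks and coordinate sums.

evenB : ℕ → Bool
evenB zero    = true
evenB (suc k) = not (evenB k)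

δ : ∀ {n} → Fin n → ℕ
δ zero    = 0
δ (suc _) = 1

δ₂ : ∀ {n} → Fin n → ℕ
δ₂ zero          = 0
δ₂ (suc zero)    = 0
δ₂ (suc (suc _)) = 1

-- `nz` is the size of the support, `big` the number of coordinates outside {0,1}. The low vertices
-- are those with `big x < s`; the flats together consist of those with `nz x ≡ s`.
nz big tot : ∀ {d n} → Vertex d n → ℕ
nz  []      = 0
nz  (a ∷ x) = δ a + nz x
big []      = 0
big (a ∷ x) = δ₂ a + big x
tot []      = 0
tot (a ∷ x) = toℕ a + tot x

-- The weight of a nonzero coordinate depends on its rank among the nonzero ones. Three weights
-- occur: `tailWeight` for layers, `oddWeight` for the order within a flat, and the constant 1,
-- which gives `tot`.
rankedSum : ∀ {d n} → (ℕ → ℕ) → Vertex d n → ℕ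
rankedSum γ []          = 0
rankedSum γ (zero ∷ x)  = rankedSum γ x
rankedSum γ (suc a ∷ x) = γ 0 * toℕ (suc a) + rankedSum (γ ∘ suc) x

rank : ∀ {d n} → Vertex d n → Fin d → ℕ
rank (_ ∷ _) zero    = 0
rank (a ∷ x) (suc i) = δ a + rank x i

δ₂≤δ : ∀ {n} (a : Fin n) → δ₂ a ≤ δ a
δ₂≤δ zero          = z≤n
δ₂≤δ (suc zero)    = z≤n
δ₂≤δ (suc (suc _)) = ≤-refl

δ≤toℕ : ∀ {n} (a : Fin n) → δ a ≤ toℕ a
δ≤toℕ zero    = z≤n
δ≤toℕ (suc a) = s≤s z≤n

big≤nz : ∀ {d n} (x : Vertex d n) → big x ≤ nz x
big≤nz []      = z≤n
big≤nz (a ∷ x) = +-mono-≤ (δ₂≤δ a) (big≤nz x)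

nz≤tot : ∀ {d n} (x : Vertex d n) → nz x ≤ tot x
nz≤tot []      = z≤n
nz≤tot (a ∷ x) = +-mono-≤ (δ≤toℕ a) (nz≤tot x)

nz≡0⇒tot≡0 : ∀ {d n} (x : Vertex d n) → nz x ≡ 0 → tot x ≡ 0
nz≡0⇒tot≡0 []         _ = refl
nz≡0⇒tot≡0 (zero ∷ x) e = nz≡0⇒tot≡0 x e

nz≡∑ : ∀ {d n} (x : Vertex d n) → nz x ≡ ∑ (δ ∘ lookup x)
nz≡∑ []      = refl
nz≡∑ (a ∷ x) = cong (δ a +_) (nz≡∑ x)

-- Used in the contrapositive: where `big` and `nz` agree, every nonzero coordinate is at least 2,
-- so lowering it keeps the support.
lookup≡1⇒big<nz : ∀ {d n} (x : Vertex d (suc (suc n))) i → lookup x i ≡ suc zero → big x < nz x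
lookup≡1⇒big<nz (a ∷ x) zero    refl = s≤s (big≤nz x)
lookup≡1⇒big<nz (a ∷ x) (suc i) e    = +-mono-≤-< (δ₂≤δ a) (lookup≡1⇒big<nz x i e)

rank-surjective : ∀ {d n} (x : Vertex d n) j → j < nz x → ∃ λ i → rank x i ≡ j × δ (lookup x i) ≡ 1
rank-surjective (zero ∷ x)  j       j<nz =
  let i , e , f = rank-surjective x j j<nz in suc i , e , f
rank-surjective (suc a ∷ x) zero    j<nz = zero , refl , refl
rank-surjective (suc a ∷ x) (suc j) (s≤s j<nz) =
  let i , e , f = rank-surjective x j j<nz in suc i , cong suc e , f

zero-coordinate : ∀ {d n} (x : Vertex d (suc n)) → nz x < d → ∃ λ i → lookup x i ≡ zero
zero-coordinate (zero ∷ x)  p       = zero , refl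
zero-coordinate (suc a ∷ x) (s≤s p) = let i , e = zero-coordinate x p in suc i , e

big-≔ : ∀ {d n} (x : Vertex d n) i v → δ₂ v ≤ δ₂ (lookup x i) → big (x [ i ]≔ v) ≤ big x
big-≔ (a ∷ x) zero    v p = +-monoˡ-≤ (big x) p
big-≔ (a ∷ x) (suc i) v p = +-monoʳ-≤ (δ₂ a) (big-≔ x i v p)

big-≔-< : ∀ {d n} (x : Vertex d n) i v → δ₂ v < δ₂ (lookup x i) → big (x [ i ]≔ v) < big x
big-≔-< (a ∷ x) zero    v p = +-monoˡ-< (big x) p
big-≔-< (a ∷ x) (suc i) v p = +-monoʳ-< (δ₂ a) (big-≔-< x i v p)

-- Stated additively, which avoids truncated subtraction.
tot-≔ : ∀ {d n} (x : Vertex d n) i v → tot (x [ i ]≔ v) + toℕ (lookup x i) ≡ tot x + toℕ v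
tot-≔ (a ∷ x) zero    v = begin
  (toℕ v + tot x) + toℕ a ≡⟨ +-comm (toℕ v + tot x) (toℕ a) ⟩
  toℕ a + (toℕ v + tot x) ≡⟨ cong (toℕ a +_) (+-comm (toℕ v) (tot x)) ⟩
  toℕ a + (tot x + toℕ v) ≡⟨ sym (+-assoc (toℕ a) (tot x) (toℕ v)) ⟩
  (toℕ a + tot x) + toℕ v ∎
  where open ≡-Reasoning
tot-≔ (a ∷ x) (suc i) v =
  trans (+-assoc (toℕ a) _ _) (trans (cong (toℕ a +_) (tot-≔ x i v)) (sym (+-assoc (toℕ a) _ _)))

-- Inc k x y: y arises from x by adding 1 to its k-th (from 0) nonzero coordinate, without wrapping.
data Inc {n : ℕ} : ∀ {d} → ℕ → Vertex d (suc n) → Vertex d (suc n) → Set where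
  here  : ∀ {d} {a b : Fin n} {x : Vertex d (suc n)} → toℕ b ≡ suc (toℕ a) → Inc 0 (suc a ∷ x) (suc b ∷ x)
  there : ∀ {d} {k} {x y : Vertex d (suc n)} a → Inc k x y → Inc (δ a + k) (a ∷ x) (a ∷ y)

Inc-nz : ∀ {d n k} {x y : Vertex d (suc n)} → Inc k x y → nz y ≡ nz x
Inc-nz (here _)    = refl
Inc-nz (there a p) = cong (δ a +_) (Inc-nz p)

Inc-tot : ∀ {d n k} {x y : Vertex d (suc n)} → Inc k x y → tot y ≡ suc (tot x)
Inc-tot (here e)            = cong (λ b → suc (b + _)) e
Inc-tot (there {x = x} a p) = trans (cong (toℕ a +_) (Inc-tot p)) (+-suc (toℕ a) (tot x))

-- An increment keeps the support and hence every rank, so only the term of rank `k` changes.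
Inc-rankedSum : ∀ {d n k} {x y : Vertex d (suc n)} γ → Inc k x y → rankedSum γ y ≡ γ k + rankedSum γ x
Inc-rankedSum γ (here {a = a} {b} {x} e) = begin
  γ 0 * suc (toℕ b) + rankedSum (γ ∘ suc) x             ≡⟨ cong (λ v → γ 0 * suc v + rankedSum (γ ∘ suc) x) e ⟩
  γ 0 * suc (suc (toℕ a)) + rankedSum (γ ∘ suc) x       ≡⟨ cong (_+ rankedSum (γ ∘ suc) x) (*-suc (γ 0) (suc (toℕ a))) ⟩
  γ 0 + γ 0 * suc (toℕ a) + rankedSum (γ ∘ suc) x       ≡⟨ +-assoc (γ 0) _ _ ⟩
  γ 0 + (γ 0 * suc (toℕ a) + rankedSum (γ ∘ suc) x)     ∎
  where open ≡-Reasoning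
Inc-rankedSum γ (there zero p)    = Inc-rankedSum γ p
Inc-rankedSum γ (there {k = k} {x} {y} (suc a) p) = begin
  γ 0 * suc (toℕ a) + rankedSum (γ ∘ suc) y                ≡⟨ cong (γ 0 * suc (toℕ a) +_) (Inc-rankedSum (γ ∘ suc) p) ⟩
  γ 0 * suc (toℕ a) + (γ (suc k) + rankedSum (γ ∘ suc) x)  ≡⟨ sym (+-assoc (γ 0 * suc (toℕ a)) (γ (suc k)) _) ⟩
  γ 0 * suc (toℕ a) + γ (suc k) + rankedSum (γ ∘ suc) x    ≡⟨ cong (_+ rankedSum (γ ∘ suc) x) (+-comm _ (γ (suc k))) ⟩
  γ (suc k) + γ 0 * suc (toℕ a) + rankedSum (γ ∘ suc) x    ≡⟨ +-assoc (γ (suc k)) _ _ ⟩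
  γ (suc k) + (γ 0 * suc (toℕ a) + rankedSum (γ ∘ suc) x)  ∎
  where open ≡-Reasoning

Inc-dn : ∀ {d n} (x : Vertex d (suc (suc n))) i {a} → lookup x i ≡ suc (suc a) →
  Inc (rank x i) (x [ i ]≔ dn (lookup x i)) x
Inc-dn (_ ∷ x) zero    {a} refl = here (cong suc (sym (toℕ-inject₁ a)))
Inc-dn (b ∷ x) (suc i) e        = there b (Inc-dn x i e)

Inc-up : ∀ {d n} (x : Vertex d (suc (suc n))) i {a} → lookup x i ≡ suc (suc a) →
  toℕ (up (lookup x i)) ≡ suc (toℕ (lookup x i)) → Inc (rank x i) x (x [ i ]≔ up (lookup x i))
Inc-up (_ ∷ x) zero {a} refl u with up (suc (suc a))
... | suc b = here (suc-injective u)
Inc-up (b ∷ x) (suc i) e u = there b (Inc-up x i e u)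

-- Wrapping turns a coordinate outside {0,1} into 0, so `big` drops; starting in a flat, the result
-- is a low vertex, active at all times.
up-wrap-or-Inc : ∀ {d n} (x : Vertex d (suc (suc n))) i {a} → lookup x i ≡ suc (suc a) →
  big (x [ i ]≔ up (lookup x i)) < big x ⊎ Inc (rank x i) x (x [ i ]≔ up (lookup x i))
up-wrap-or-Inc x i e with up-cases (lookup x i)
... | inj₂ u       = inj₂ (Inc-up x i e u)
... | inj₁ (u , _) = inj₁ (big-≔-< x i (up (lookup x i)) lt)
  where
  lt : δ₂ (up (lookup x i)) < δ₂ (lookup x i)
  lt rewrite u | e = s≤s z≤n

-- Layers, weights and the seed.

next : ℕ → ℕ → ℕ
next s ℓ with ℓ <? s
... | yes _ = suc ℓ
... | no _  = 0

-- The residue modulo `suc s`, built from the cyclic successor so that an increment becomes one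
-- application of `next`.
layer : ℕ → ℕ → ℕ
layer s zero    = 0
layer s (suc u) = next s (layer s u)

next-cases : ∀ s ℓ → ℓ ≤ s → (ℓ < s × next s ℓ ≡ suc ℓ) ⊎ (ℓ ≡ s × next s ℓ ≡ 0)
next-cases s ℓ ℓ≤s with ℓ <? s
... | yes p = inj₁ (p , refl)
... | no ¬p = inj₂ (≤-antisym ℓ≤s (≮⇒≥ ¬p) , refl)

next≤ : ∀ s ℓ → next s ℓ ≤ s
next≤ s ℓ with ℓ <? s
... | yes p = p
... | no _  = z≤n

layer≤ : ∀ s u → layer s u ≤ s
layer≤ s zero    = z≤n
layer≤ s (suc u) = next≤ s (layer s u)

next≡suc⇒ : ∀ s ℓ {j} → next s ℓ ≡ suc j → ℓ ≡ j
next≡suc⇒ s ℓ e with ℓ <? s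
next≡suc⇒ s ℓ refl | yes p = refl

indicator-≤1 : ∀ {b} → b ≡ true → 1 ≤ indicator b
indicator-≤1 refl = ≤-refl

≤ᵇ-true : ∀ {a b} → a ≤ b → (a ≤ᵇ b) ≡ true
≤ᵇ-true p = Equivalence.to T-≡ (≤⇒≤ᵇ p)

evenB-+suc : ∀ t u → evenB (t + suc u) ≡ evenB (suc t + u)
evenB-+suc t u = cong evenB (+-suc t u)

evenB-suc+suc : ∀ t u → evenB (suc t + suc u) ≡ evenB (t + u)
evenB-suc+suc t u = trans (cong not (evenB-+suc t u)) (not-involutive (evenB (t + u)))

evenB-+even : ∀ t {u} → evenB u ≡ true → evenB (t + u) ≡ evenB t
evenB-+even zero    e = e
evenB-+even (suc t) e = cong not (evenB-+even t e)

tailWeight : ℕ → ℕ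
tailWeight zero    = 0
tailWeight (suc _) = 1

oddWeight : ℕ → ℕ
oddWeight k = suc (k + k)

-- `pronic ℓ` is ℓ(ℓ - 1): the correction j(j + 1) of the order on a flat, indexed by the layer ℓ =
-- j + 1.
pronic : ℕ → ℕ
pronic zero    = 0
pronic (suc j) = j + j * j

pronic-suc : ∀ j → pronic (suc (suc j)) ≡ suc (suc (j + j)) + pronic (suc j)
pronic-suc j = cong suc (begin
  j + suc (j + j * suc j)      ≡⟨ +-suc j _ ⟩
  suc (j + (j + j * suc j))    ≡⟨ cong (λ z → suc (j + (j + z))) (*-suc j j) ⟩
  suc (j + (j + (j + j * j)))  ≡⟨ cong suc (sym (+-assoc j j _)) ⟩
  suc (j + j + (j + j * j))    ∎)
  where open ≡-Reasoning

-- Keeps weight plus `s * s` minus the correction nonnegative, so positions in the order can be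
-- measured by natural numbers.
pronic≤ : ∀ {ℓ s} → ℓ ≤ s → pronic ℓ ≤ s * s
pronic≤ z≤n = z≤n
pronic≤ {suc j} {suc s} (s≤s p) =
  ≤-trans (+-mono-≤ p (*-mono-≤ p p)) (m≤n⇒m≤1+n (+-monoʳ-≤ s (*-monoʳ-≤ s (n≤1+n s))))

strip : ∀ {d n} → ℕ → Config d n
strip s x = (nz x ≡ᵇ s) ∧ ((layer s (rankedSum tailWeight x) ≤ᵇ 1) ∧ evenB (tot x))

seed : ∀ {d n} → ℕ → Config d n
seed s x = (suc (big x) ≤ᵇ s) ∨ strip s x

contribution-up : ∀ {d m} (c : Config d (suc m)) x i → c (x [ i ]≔ up (lookup x i)) ≡ true →
  1 ≤ contribution c x i
contribution-up c x i p = ≤-trans (indicator-≤1 p) (m≤m+n _ _)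

contribution-dn : ∀ {d m} (c : Config d (suc m)) x i → c (x [ i ]≔ dn (lookup x i)) ≡ true →
  1 ≤ contribution c x i
contribution-dn c x i p = ≤-trans (indicator-≤1 p) (m≤n+m _ _)

-- Spread of activity from the seed, for odd n = p + 2 and threshold `suc s`.

module Dynamics (p : ℕ) (1≤p : 1 ≤ p) (even-m : evenB (suc p) ≡ true) (d s : ℕ) (s<d : s < d) where

  n : ℕ
  n = suc (suc p)

  V : Set
  V = Vertex d n

  state : ℕ → Config d n
  state t = run (suc s) t (seed s)

  ActiveAt : ℕ → V → Set
  ActiveAt t x = state t x ≡ true

  activate : ∀ t x → suc s ≤ ∑ (contribution (state t) x) → ActiveAt (suc t) x
  activate t = step-active (s≤s 1≤p) (state t)

  module _ (c : Config d n) (x : V) where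

    -- Only steps without wrapping are demanded; where no such step exists the condition holds
    -- vacuously.
    Down Up : ℕ → Set
    Down k = ∀ y → Inc k y x → c y ≡ true
    Up k   = ∀ y → Inc k x y → c y ≡ true

    -- Every support direction supplies an active neighbour and the one of rank `j` supplies two,
    -- `suc s` together. An upward step that wraps lands on a low vertex, covered by the third
    -- hypothesis.
    flat-contribution : nz x ≡ s → s ≤ big x → (∀ y → big y < s → c y ≡ true) →
      (∀ k → Down k ⊎ Up k) → ∀ j → j < s → Down j → Up j → suc s ≤ ∑ (contribution c x)
    flat-contribution nz≡s s≤big low choice j j<s dj uj =
      -- Compared term by term with `δ ∘ lookup x`, whose sum is `nz x`; the inequality is strict at
      -- the coordinate of rank `j`.
      subst (_< ∑ (contribution c x)) (trans (sym (nz≡∑ x)) nz≡s) (∑-mono-< i (strict _ refl) (λ k → weak k _ refl))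
      where
      i : Fin d
      i = proj₁ (rank-surjective x j (subst (j <_) (sym nz≡s) j<s))
      rank≡j : rank x i ≡ j
      rank≡j = proj₁ (proj₂ (rank-surjective x j (subst (j <_) (sym nz≡s) j<s)))
      δ≡1 : δ (lookup x i) ≡ 1
      δ≡1 = proj₂ (proj₂ (rank-surjective x j (subst (j <_) (sym nz≡s) j<s)))
      no-one : ∀ k → lookup x k ≡ suc zero → ⊥
      no-one k e = <⇒≱ (lookup≡1⇒big<nz x k e) (subst (_≤ big x) (sym nz≡s) s≤big)
      down : ∀ k {a} → lookup x k ≡ suc (suc a) → Down (rank x k) → c (x [ k ]≔ dn (lookup x k)) ≡ true
      down k e D = D _ (Inc-dn x k e)
      raise : ∀ k {a} → lookup x k ≡ suc (suc a) → Up (rank x k) → c (x [ k ]≔ up (lookup x k)) ≡ true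
      raise k e U with up-wrap-or-Inc x k e
      ... | inj₁ b = low _ (≤-trans b (subst (big x ≤_) nz≡s (big≤nz x)))
      ... | inj₂ q = U _ q
      weak : ∀ k a → lookup x k ≡ a → δ (lookup x k) ≤ contribution c x k
      weak k zero          e = ≤-trans (≤-reflexive (cong δ e)) z≤n
      weak k (suc zero)    e = ⊥-elim (no-one k e)
      weak k (suc (suc a)) e with choice (rank x k)
      ... | inj₁ D = ≤-trans (≤-reflexive (cong δ e)) (contribution-dn c x k (down k e D))
      ... | inj₂ U = ≤-trans (≤-reflexive (cong δ e)) (contribution-up c x k (raise k e U))
      strict : ∀ a → lookup x i ≡ a → δ (lookup x i) < contribution c x i
      strict zero e with () ← trans (sym (cong δ e)) δ≡1
      strict (suc zero) e = ⊥-elim (no-one i e)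
      strict (suc (suc a)) e =
        ≤-trans (≤-reflexive (cong (suc ∘ δ) e))
          (+-mono-≤ (indicator-≤1 (raise i e (subst Up (sym rank≡j) uj)))
                    (indicator-≤1 (down i e (subst Down (sym rank≡j) dj))))

  low-active : ∀ t x → big x < s → ActiveAt t x
  low-active zero    x b rewrite ≤ᵇ-true b = refl
  low-active (suc t) x b =
    activate t x (≤-trans s<d (subst (_≤ ∑ (contribution (state t) x)) (trans (∑-const d 1) (*-identityʳ d))
      (∑-mono-≤ (λ i → each i _ refl))))
    where
    stay : ∀ i v → δ₂ v ≤ δ₂ (lookup x i) → ActiveAt t (x [ i ]≔ v)
    stay i v q = low-active t _ (≤-trans (s≤s (big-≔ x i v q)) b)
    each : ∀ i a → lookup x i ≡ a → 1 ≤ contribution (state t) x i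
    -- The step goes from 0 up to 1 and otherwise down; neither increases `big`.
    each i zero e = contribution-up (state t) x i (stay i _ (subst (λ a → δ₂ (up a) ≤ δ₂ a) (sym e) z≤n))
    each i (suc a) e = contribution-dn (state t) x i (stay i _ (subst (λ a → δ₂ (dn a) ≤ δ₂ a) (sym e) (δ₂-dn a)))
      where
      δ₂-dn : ∀ a → δ₂ (inject₁ a) ≤ δ₂ (suc a)
      δ₂-dn zero          = z≤n
      δ₂-dn (suc zero)    = z≤n
      δ₂-dn (suc (suc a)) = ≤-refl

  -- Activity within the flats.

  ℓ : V → ℕ
  ℓ x = layer s (rankedSum tailWeight x)

  ℓ-head : ∀ {x y} → Inc 0 x y → ℓ y ≡ ℓ x
  ℓ-head q = cong (layer s) (Inc-rankedSum tailWeight q)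

  ℓ-tail : ∀ {k x y} → Inc (suc k) x y → ℓ y ≡ next s (ℓ x)
  ℓ-tail q = cong (layer s) (Inc-rankedSum tailWeight q)

  -- A step without wrapping changes the parity of `tot` and a round changes that of the time, so
  -- such neighbours in the previous round lie on the same sheet.
  even-below : ∀ t {k} {x y : V} → Inc k y x → evenB (suc t + tot x) ≡ true → evenB (t + tot y) ≡ true
  even-below t {x = x} {y} q e =
    trans (sym (evenB-suc+suc t (tot y))) (trans (cong (λ u → evenB (suc t + u)) (sym (Inc-tot q))) e)

  even-above : ∀ t {k} {x y : V} → Inc k x y → evenB (suc t + tot x) ≡ true → evenB (t + tot y) ≡ true
  even-above t {x = x} {y} q e =
    trans (cong (λ u → evenB (t + u)) (Inc-tot q)) (trans (evenB-+suc t (tot x)) e)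

  -- With threshold 1 and empty support there is no flat direction to use: the vertex activates a
  -- neighbour in a zero direction, which activates it in turn one round later.
  back-and-forth : ∀ t x → s ≡ 0 → nz x ≡ s → ActiveAt t x → ActiveAt (suc (suc t)) x
  back-and-forth t x s≡0 nz≡s act =
    activate (suc t) x (enough (suc t) x i (contribution-up (state (suc t)) x i
      (subst (ActiveAt (suc t)) (cong (x [ i ]≔_) (sym (cong up e)))
        (activate t y (enough t y i (contribution-dn (state t) y i (subst (ActiveAt t) (sym back) act)))))))
    where
    i : Fin d
    i = proj₁ (zero-coordinate x (subst (_< d) (sym nz≡s) s<d))
    e : lookup x i ≡ zero
    e = proj₂ (zero-coordinate x (subst (_< d) (sym nz≡s) s<d))
    y : V
    y = x [ i ]≔ suc zero
    back : y [ i ]≔ dn (lookup y i) ≡ x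
    back = begin
      y [ i ]≔ dn (lookup y i) ≡⟨ cong (λ v → y [ i ]≔ dn v) (Vec.lookup∘update i x (suc zero)) ⟩
      y [ i ]≔ zero            ≡⟨ Vec.[]≔-idempotent x i ⟩
      x [ i ]≔ zero            ≡⟨ cong (x [ i ]≔_) (sym e) ⟩
      x [ i ]≔ lookup x i      ≡⟨ Vec.[]≔-lookup x i ⟩
      x                        ∎
      where open ≡-Reasoning
    enough : ∀ t x i → 1 ≤ contribution (state t) x i →
      suc s ≤ ∑ (contribution (state t) x)
    enough t x i q = ≤-trans (≤-reflexive (cong suc s≡0)) (≤-trans q (≤-∑ (contribution (state t) x) i))

  -- Both steps along the first support coordinate keep the layer; along any other, layer 0 goes up
  -- and layer 1 goes down, staying in the strip. Low vertices and `s` zero are treated apart.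
  strip-active : ∀ t x → nz x ≡ s → ℓ x ≤ 1 → evenB (t + tot x) ≡ true → ActiveAt t x
  strip-active zero x nz≡s ℓ≤1 e
    rewrite nz≡s | ≡ᵇ-refl s | ≤ᵇ-true ℓ≤1 | e = ∨-zeroʳ (suc (big x) ≤ᵇ s)
  strip-active (suc t) x nz≡s ℓ≤1 e with big x <? s | s ≤? 0
  ... | yes b | _ = low-active (suc t) x b
  ... | no ¬b | no s>0 =
    activate t x (flat-contribution (state t) x nz≡s (≮⇒≥ ¬b) (low-active t)
                    choice 0 (≰⇒> s>0) down₀ up₀)
    where
    c : Config d n
    c = state t
    down₀ : Down c x 0
    down₀ y q = strip-active t y (trans (sym (Inc-nz q)) nz≡s) (subst (_≤ 1) (ℓ-head q) ℓ≤1) (even-below t q e)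
    up₀ : Up c x 0
    up₀ y q = strip-active t y (trans (Inc-nz q) nz≡s) (subst (_≤ 1) (sym (ℓ-head q)) ℓ≤1) (even-above t q e)
    choice : ∀ k → Down c x k ⊎ Up c x k
    choice zero    = inj₁ down₀
    choice (suc k) with ℓ x in ℓ≡
    ... | zero        = inj₂ λ y q → strip-active t y (trans (Inc-nz q) nz≡s)
      (≤-trans (≤-reflexive (trans (ℓ-tail q) (cong (next s) ℓ≡))) next-zero) (even-above t q e)
      where
      next-zero : next s 0 ≤ 1
      next-zero with next-cases s 0 z≤n
      ... | inj₁ (_ , r) = ≤-reflexive r
      ... | inj₂ (_ , r) = ≤-trans (≤-reflexive r) z≤n
    ... | suc zero    = inj₁ λ y q → strip-active t y (trans (sym (Inc-nz q)) nz≡s)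
      (≤-trans (≤-reflexive (next≡suc⇒ s (ℓ y) (trans (sym (ℓ-tail q)) ℓ≡))) z≤n) (even-below t q e)
    ... | suc (suc _) = ⊥-elim (contra ℓ≤1)
      where
      contra : ∀ {k} → suc (suc k) ≤ 1 → ⊥
      contra (s≤s ())
  -- For `s` zero the vertex is the origin, with `tot` zero: parity rules out time 1, and the
  -- induction advances two rounds at once.
  strip-active (suc zero) x nz≡s ℓ≤1 e | no _ | yes s≤0 with () ← trans (sym e) (cong (not ∘ evenB) (nz≡0⇒tot≡0 x (trans nz≡s (n≤0⇒n≡0 s≤0))))
  strip-active (suc (suc t)) x nz≡s ℓ≤1 e | no _ | yes s≤0 =
    back-and-forth t x (n≤0⇒n≡0 s≤0) nz≡s
      (strip-active t x nz≡s ℓ≤1 (trans (sym (not-involutive (evenB (t + tot x)))) e))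

  weight : V → ℕ
  weight = rankedSum oddWeight

  -- Induction on `φ`, which exceeds the position weight + s² - `pronic` of the vertex. The
  -- neighbours used outside the strip and the low set have smaller positions and are needed one
  -- round earlier, so `φ ≤ t` is inherited.
  flat-active : ∀ φ t x → nz x ≡ s → evenB (t + tot x) ≡ true → φ ≤ t →
    weight x + s * s < φ + pronic (ℓ x) → ActiveAt t x
  flat-active zero t x nz≡s e _ lt =
    ⊥-elim (<⇒≱ lt (≤-trans (pronic≤ (layer≤ s (rankedSum tailWeight x))) (m≤n+m (s * s) (weight x))))
  flat-active (suc φ) (suc t) x nz≡s e (s≤s φ≤t) (s≤s w≤) with big x <? s | ℓ x in ℓ≡
  ... | yes b | _          = low-active (suc t) x b
  ... | no _  | zero       = strip-active (suc t) x nz≡s (≤-trans (≤-reflexive ℓ≡) z≤n) e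
  ... | no _  | suc zero   = strip-active (suc t) x nz≡s (≤-reflexive ℓ≡) e
  ... | no ¬b | suc (suc i) =
    activate t x (flat-contribution (state t) x nz≡s (≮⇒≥ ¬b) (low-active t)
                    -- Rank `suc i` admits both directions; it is less than `s` because the layer
                    -- `suc (suc i)` is at most `s`.
                    choice (suc i) (subst (_≤ s) ℓ≡ (layer≤ s (rankedSum tailWeight x)))
                    (down i ≤-refl) (raised i ≤-refl))
    where
    down₀ : Down (state t) x 0
    down₀ y q = flat-active φ t y (trans (sym (Inc-nz q)) nz≡s) (even-below t q e) φ≤t
      (subst₂ (λ w l → w + s * s ≤ φ + pronic l) (Inc-rankedSum oddWeight q) (trans (sym ℓ≡) (ℓ-head q)) w≤)
    down : ∀ k → suc i ≤ suc k → Down (state t) x (suc k)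
    -- The weight falls by 2k + 3, while the correction falls by 2i + 2, at most 2k + 2.
    down k i≤k y q = flat-active φ t y (trans (sym (Inc-nz q)) nz≡s) (even-below t q e) φ≤t
      (subst (λ l → weight y + s * s < φ + pronic l) (sym ℓy≡)
        (cancel {weight y} {φ} {pronic (suc i)} (+-mono-≤ i≤k i≤k)
          (subst₂ _≤_ (cong (_+ s * s) (Inc-rankedSum oddWeight q))
             (cong (φ +_) (trans (pronic-suc i) (cong (_+ pronic (suc i)) (cong suc (sym (+-suc i i)))))) w≤)))
      where
      ℓy≡ : ℓ y ≡ suc i
      ℓy≡ = next≡suc⇒ s (ℓ y) (trans (sym (ℓ-tail q)) ℓ≡)
      cancel : ∀ {w φ P a b} → b ≤ a → suc a + w + s * s ≤ φ + (b + P) → w + s * s < φ + P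
      cancel {w} {φ} {P} {a} {b} b≤a le = +-cancelˡ-≤ a _ _ (begin
        a + suc (w + s * s)   ≡⟨ +-suc a _ ⟩
        suc (a + (w + s * s)) ≡⟨ cong suc (sym (+-assoc a w _)) ⟩
        suc a + w + s * s     ≤⟨ le ⟩
        φ + (b + P)           ≡⟨ x∙yz≈y∙xz +-commutativeSemigroup φ b P ⟩
        b + (φ + P)           ≤⟨ +-monoˡ-≤ (φ + P) b≤a ⟩
        a + (φ + P)           ∎)
        where open ≤-Reasoning
    raised : ∀ k → suc k ≤ suc i → Up (state t) x (suc k)
    -- From layer `s` the step returns to layer 0, in the strip. Otherwise the weight grows by 2k +
    -- 3, at most 2i + 3, and the correction by 2i + 4.
    raised k k≤i y q with next-cases s (suc (suc i)) (subst (_≤ s) ℓ≡ (layer≤ s (rankedSum tailWeight x)))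
    ... | inj₂ (_ , r) =
      strip-active t y (trans (Inc-nz q) nz≡s)
        (≤-trans (≤-reflexive (trans (ℓ-tail q) (trans (cong (next s) ℓ≡) r))) z≤n) (even-above t q e)
    ... | inj₁ (_ , r) = flat-active φ t y (trans (Inc-nz q) nz≡s) (even-above t q e) φ≤t (begin
      suc (weight y + s * s)
        ≡⟨ cong (λ w → suc (w + s * s)) (Inc-rankedSum oddWeight q) ⟩
      suc (suc (suc k + suc k)) + weight x + s * s
        ≡⟨ +-assoc (suc (suc (suc k + suc k))) (weight x) (s * s) ⟩
      suc (suc (suc k + suc k)) + (weight x + s * s)
        ≤⟨ +-mono-≤ (s≤s (s≤s (+-mono-≤ k≤i k≤i))) w≤ ⟩
      suc (suc (suc i + suc i)) + (φ + pronic (suc (suc i)))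
        ≡⟨ x∙yz≈y∙xz +-commutativeSemigroup (suc (suc (suc i + suc i))) φ _ ⟩
      φ + (suc (suc (suc i + suc i)) + pronic (suc (suc i)))
        ≡⟨ cong (φ +_) (sym (pronic-suc (suc i))) ⟩
      φ + pronic (suc (suc (suc i)))
        ≡⟨ cong (λ l → φ + pronic l) (sym (trans (ℓ-tail q) (trans (cong (next s) ℓ≡) r))) ⟩
      φ + pronic (ℓ y) ∎)
      where open ≤-Reasoning
    choice : ∀ k → Down (state t) x k ⊎ Up (state t) x k
    choice zero    = inj₁ down₀
    choice (suc k) with ≤-total (suc i) (suc k)
    ... | inj₁ i≤k = inj₁ (down k i≤k)
    ... | inj₂ k≤i = inj₂ (raised k k≤i)

  -- The sum of all weights is a crude common bound for the single ones.
  T₁ : ℕ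
  T₁ = suc (∑ᵥ weight + s * s)

  flat-active-from-T₁ : ∀ t x → nz x ≡ s → evenB (t + tot x) ≡ true → T₁ ≤ t → ActiveAt t x
  flat-active-from-T₁ t x nz≡s e T₁≤t = flat-active T₁ t x nz≡s e T₁≤t
    (≤-trans (s≤s (+-monoˡ-≤ (s * s) (≤-∑ᵥ weight x))) (m≤m+n T₁ _))

  -- Filling both sheets of the torus from the corner.

  tot-dn : ∀ (x : V) i {a} → lookup x i ≡ suc a → tot x ≡ suc (tot (x [ i ]≔ dn (lookup x i)))
  tot-dn x i {a} e = sym (+-cancelʳ-≡ (toℕ a) _ _ (begin
    suc (tot (x [ i ]≔ dn (lookup x i))) + toℕ a
      ≡⟨ sym (+-suc _ (toℕ a)) ⟩
    tot (x [ i ]≔ dn (lookup x i)) + suc (toℕ a)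
      ≡⟨ cong (λ v → tot (x [ i ]≔ dn (lookup x i)) + toℕ v) (sym e) ⟩
    tot (x [ i ]≔ dn (lookup x i)) + toℕ (lookup x i)
      ≡⟨ tot-≔ x i _ ⟩
    tot x + toℕ (dn (lookup x i))
      ≡⟨ cong (λ v → tot x + toℕ (dn v)) e ⟩
    tot x + toℕ (inject₁ a)
      ≡⟨ cong (tot x +_) (toℕ-inject₁ a) ⟩
    tot x + toℕ a ∎))
    where open ≡-Reasoning

  DownNeighboursActive : ℕ → V → Set
  DownNeighboursActive t x = ∀ i {a} → lookup x i ≡ suc a → ActiveAt t (x [ i ]≔ dn (lookup x i))

  δ≤contribution : ∀ t x → DownNeighboursActive t x → ∀ i → δ (lookup x i) ≤ contribution (state t) x i
  δ≤contribution t x D i = by-value _ refl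
    where
    by-value : ∀ a → lookup x i ≡ a → δ (lookup x i) ≤ contribution (state t) x i
    by-value zero    e = ≤-trans (≤-reflexive (cong δ e)) z≤n
    by-value (suc a) e = ≤-trans (≤-reflexive (cong δ e)) (contribution-dn (state t) x i (D i e))

  corner : ∀ t x → s < nz x → DownNeighboursActive t x → ActiveAt (suc t) x
  corner t x s<nz D = activate t x (≤-trans s<nz (subst (_≤ ∑ (contribution (state t) x)) (sym (nz≡∑ x))
    (∑-mono-≤ (δ≤contribution t x D))))

  -- The `s` down neighbours fall one short of the threshold; the wrapping neighbour in a zero
  -- direction is the missing one.
  corner-wrap : ∀ t x i → nz x ≡ s → lookup x i ≡ zero → ActiveAt t (x [ i ]≔ dn (lookup x i)) →
    DownNeighboursActive t x → ActiveAt (suc t) x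
  corner-wrap t x i nz≡s e act D =
    activate t x (subst (_< ∑ (contribution (state t) x)) (trans (sym (nz≡∑ x)) nz≡s)
      (∑-mono-< i (≤-trans (≤-reflexive (cong (suc ∘ δ) e)) (contribution-dn (state t) x i act))
        (δ≤contribution t x D)))

  -- Induction on the coordinate sum: vertices with support smaller than `s` are low, those with
  -- support of size `s` lie in flats, and the others have at least `suc s` down neighbours on the
  -- same sheet in the previous round.
  even-active : ∀ k t x → tot x ≤ k → T₁ + k ≤ t → evenB (t + tot x) ≡ true → ActiveAt t x
  even-active k t x tot≤k T≤t e with <-cmp (nz x) s
  ... | tri< nz<s _ _ = low-active t x (≤-trans (s≤s (big≤nz x)) nz<s)
  ... | tri≈ _ nz≡s _ = flat-active-from-T₁ t x nz≡s e (≤-trans (m≤m+n T₁ k) T≤t)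
  even-active zero t x tot≤k T≤t e | tri> _ _ s<nz =
    ⊥-elim (<⇒≱ s<nz (≤-trans (nz≤tot x) (≤-trans tot≤k z≤n)))
  even-active (suc k) zero x tot≤k T≤t e | tri> _ _ s<nz with () ← T≤t
  even-active (suc k) (suc t) x tot≤k T≤t e | tri> _ _ s<nz = corner t x s<nz λ i q →
    even-active k t _ (≤-pred (subst (_≤ suc k) (tot-dn x i q) tot≤k))
      (≤-pred (subst (_≤ suc t) (+-suc T₁ k) T≤t))
      (trans (sym (evenB-suc+suc t _)) (trans (cong (λ u → evenB (suc t + u)) (sym (tot-dn x i q))) e))

  M T₂ : ℕ
  M  = ∑ᵥ {d} {n} tot
  T₂ = T₁ + M

  even-active-from-T₂ : ∀ t x → T₂ ≤ t → evenB (t + tot x) ≡ true → ActiveAt t x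
  even-active-from-T₂ t x = even-active M t x (≤-∑ᵥ tot x)

  -- The largest coordinate `suc p` is even, so wrapping keeps the parity of `tot` while the round
  -- changes that of the time: the odd sheet is reached from the even one.
  wrap-even : ∀ t (x : V) i → lookup x i ≡ zero → evenB (suc t + tot x) ≡ false →
    evenB (t + tot (x [ i ]≔ dn (lookup x i))) ≡ true
  wrap-even t x i e f = begin
    evenB (t + tot (x [ i ]≔ dn (lookup x i))) ≡⟨ cong (λ u → evenB (t + u)) tot≡ ⟩
    evenB (t + (tot x + suc p))                ≡⟨ cong evenB (sym (+-assoc t (tot x) (suc p))) ⟩
    evenB ((t + tot x) + suc p)                ≡⟨ evenB-+even (t + tot x) even-m ⟩
    evenB (t + tot x)                          ≡⟨ sym (not-involutive _) ⟩
    not (evenB (suc t + tot x))                ≡⟨ cong not f ⟩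
    true                                       ∎
    where
    open ≡-Reasoning
    tot≡ : tot (x [ i ]≔ dn (lookup x i)) ≡ tot x + suc p
    tot≡ = begin
      tot (x [ i ]≔ dn (lookup x i))                    ≡⟨ sym (+-identityʳ _) ⟩
      tot (x [ i ]≔ dn (lookup x i)) + 0                ≡⟨ cong (λ v → tot (x [ i ]≔ dn (lookup x i)) + toℕ v) (sym e) ⟩
      tot (x [ i ]≔ dn (lookup x i)) + toℕ (lookup x i) ≡⟨ tot-≔ x i _ ⟩
      tot x + toℕ (dn (lookup x i))                     ≡⟨ cong (λ v → tot x + toℕ (dn v)) e ⟩
      tot x + toℕ (fromℕ (suc p))                       ≡⟨ cong (tot x +_) (toℕ-fromℕ (suc p)) ⟩
      tot x + suc p                                     ∎

  -- The even sheet is full from `T₂` on. On the odd one the induction on `tot` is repeated, with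
  -- the flats now activated through wrapping neighbours.
  active : ∀ k t x → tot x ≤ k → T₂ + suc k ≤ t → ActiveAt t x
  below : ∀ k t x → tot x ≤ k → T₂ + k ≤ t → DownNeighboursActive t x

  below zero    t x tot≤k T≤t i q with () ← ≤-trans (≤-reflexive (sym (tot-dn x i q))) tot≤k
  below (suc k) t x tot≤k T≤t i q =
    active k t _ (≤-pred (subst (_≤ suc k) (tot-dn x i q) tot≤k)) T≤t

  active k zero x tot≤k T≤t with () ← subst (_≤ 0) (+-suc T₂ k) T≤t
  active k (suc t) x tot≤k T≤t with evenB (suc t + tot x) in f
  ... | true  = even-active-from-T₂ (suc t) x (≤-trans (m≤m+n T₂ (suc k)) T≤t) f
  ... | false with <-cmp (nz x) s
  ... | tri< nz<s _ _ = low-active (suc t) x (≤-trans (s≤s (big≤nz x)) nz<s)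
  ... | tri≈ _ nz≡s _ = corner-wrap t x i nz≡s e
      (even-active-from-T₂ t _ (≤-trans (m≤m+n T₂ k) T+k≤t) (wrap-even t x i e f)) (below k t x tot≤k T+k≤t)
    where
    i : Fin d
    i = proj₁ (zero-coordinate x (subst (_< d) (sym nz≡s) s<d))
    e : lookup x i ≡ zero
    e = proj₂ (zero-coordinate x (subst (_< d) (sym nz≡s) s<d))
    T+k≤t : T₂ + k ≤ t
    T+k≤t = ≤-pred (subst (_≤ suc t) (+-suc T₂ k) T≤t)
  ... | tri> _ _ s<nz = corner t x s<nz (below k t x tot≤k (≤-pred (subst (_≤ suc t) (+-suc T₂ k) T≤t)))

  seed-dynamo : IsDynamo d n (suc s) (seed s)
  seed-dynamo = T₂ + suc M , λ t T≤t x → active M t x (≤-∑ᵥ tot x) T≤t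

-- Size of the seed.

indicator-∨ : ∀ a b → indicator (a ∨ b) ≤ indicator a + indicator b
indicator-∨ true  b = s≤s z≤n
indicator-∨ false b = ≤-refl

indicator-∧ : ∀ a b → indicator (a ∧ b) ≡ indicator b * indicator a
indicator-∧ true  true  = refl
indicator-∧ true  false = refl
indicator-∧ false true  = refl
indicator-∧ false false = refl

lowCount : ℕ → ℕ → ℕ → ℕ
lowCount d n s = ∑ᵥ {d} {n} (λ x → indicator (suc (big x) ≤ᵇ s))

-- The factor n on the left replaces the exponent s - 1. The first coordinate is 0, is 1, or is one
-- of `p` other values that use up one unit of `s`; each of the three cases obeys the same bound,
-- whence the 3.
lowCount≤ : ∀ d p s → suc (suc p) * lowCount d (suc (suc p)) s ≤ 3 ^ d * suc (suc p) ^ s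
lowCount≤ d p zero = ≤-trans (≤-reflexive (trans (cong (suc (suc p) *_) (∑ᵥ-zero d (suc (suc p)))) (*-zeroʳ (suc (suc p))))) z≤n
lowCount≤ zero p (suc s) = begin
  n * 1             ≤⟨ *-monoʳ-≤ n (m^n>0 n s) ⟩
  n * n ^ s         ≡⟨ sym (+-identityʳ _) ⟩
  n * n ^ s + 0     ∎
  where
  open ≤-Reasoning
  n = suc (suc p)
lowCount≤ (suc d) p (suc s) = begin
  n * lowCount (suc d) n (suc s)
    ≡⟨ cong (n *_) (∑ᵥ-∷ {d} {n} (λ x → indicator (suc (big x) ≤ᵇ suc s))) ⟩
  n * (L + (L + ∑ {p} (λ _ → L′)))
    ≡⟨ cong (λ z → n * (L + (L + z))) (∑-const p L′) ⟩
  n * (L + (L + p * L′))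
    ≡⟨ solve 4 (λ n L p L′ → n :* (L :+ (L :+ p :* L′)) := n :* L :+ (n :* L :+ p :* (n :* L′))) refl n L p L′ ⟩
  n * L + (n * L + p * (n * L′))
    ≤⟨ +-mono-≤ ih (+-mono-≤ ih (*-mono-≤ {p} {n} (≤-trans (n≤1+n p) (n≤1+n (suc p))) (lowCount≤ d p s))) ⟩
  3 ^ d * n ^ suc s + (3 ^ d * n ^ suc s + n * (3 ^ d * n ^ s))
    ≡⟨ solve 3 (λ a b n → a :* (n :* b) :+ (a :* (n :* b) :+ n :* (a :* b)) := (con 3 :* a) :* (n :* b)) refl (3 ^ d) (n ^ s) n ⟩
  3 ^ suc d * n ^ suc s ∎
  where
  open ≤-Reasoning
  open +-*-Solver
  n = suc (suc p)
  L = lowCount d n (suc s)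
  L′ = lowCount d n s
  ih = lowCount≤ d p (suc s)

nC0≡1 : ∀ n → n C 0 ≡ 1
nC0≡1 n = trans (nCk≡nC[n∸k] {0} {n} z≤n) (nCn≡1 n)

-- An even range splits into pairs of consecutive values, with one even member each.
parity-count : ∀ m u → evenB m ≡ true →
  2 * ∑ {m} (λ a → indicator (evenB (toℕ a + u))) ≡ m
parity-count zero          u e = refl
parity-count (suc (suc m)) u e = begin
  2 * (indicator (evenB u) + (indicator (not (evenB u)) + ∑ {m} (λ a → indicator (evenB (suc (suc (toℕ a)) + u)))))
    ≡⟨ cong (λ z → 2 * (indicator (evenB u) + (indicator (not (evenB u)) + z)))
         (∑-cong {m} (λ a → cong indicator (not-involutive (evenB (toℕ a + u))))) ⟩
  2 * (indicator (evenB u) + (indicator (not (evenB u)) + S))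
    ≡⟨ cong (2 *_) (one (evenB u) S) ⟩
  2 * suc S
    ≡⟨ *-suc 2 S ⟩
  suc (suc (2 * S))
    ≡⟨ cong (λ z → suc (suc z)) (parity-count m u (trans (sym (not-involutive (evenB m))) e)) ⟩
  suc (suc m) ∎
  where
  open ≡-Reasoning
  S = ∑ {m} (λ a → indicator (evenB (toℕ a + u)))
  one : ∀ b S → indicator b + (indicator (not b) + S) ≡ suc S
  one true  S = refl
  one false S = refl

-- Leaving one of the layers 0 and 1 raises it by at most 2 − r, leaving any other layer by at most 2; so along
-- m consecutive layers, r times the number of visits to 0 and 1 is at most 2 m plus the drop of the potential.
potential : ℕ → ℕ → ℕ
potential s zero          = suc s + suc s
potential s (suc zero)    = suc s + 2
potential s (suc (suc k)) = suc (suc k) + suc (suc k)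

potential≤ : ∀ s ℓ → 1 ≤ s → ℓ ≤ s → potential s ℓ ≤ suc s + suc s
potential≤ s zero          1≤s ℓ≤s = ≤-refl
potential≤ s (suc zero)    1≤s ℓ≤s = +-monoʳ-≤ (suc s) (s≤s 1≤s)
potential≤ s (suc (suc k)) 1≤s ℓ≤s = +-mono-≤ (m≤n⇒m≤1+n ℓ≤s) (m≤n⇒m≤1+n ℓ≤s)

potential-next : ∀ s ℓ → 1 ≤ s → ℓ ≤ s →
  suc s * indicator (ℓ ≤ᵇ 1) + potential s (next s ℓ) ≤ 2 + potential s ℓ
potential-next s ℓ 1≤s ℓ≤s with next-cases s ℓ ℓ≤s
potential-next s zero 1≤s ℓ≤s | inj₁ (_ , e) rewrite e | *-identityʳ s =
  ≤-reflexive (solve 1 (λ s → con 1 :+ s :+ (con 1 :+ s :+ con 2) := con 2 :+ (con 1 :+ s :+ (con 1 :+ s))) refl s)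
  where open +-*-Solver
potential-next s zero 1≤s ℓ≤s | inj₂ (refl , _) with () ← 1≤s
potential-next s (suc zero) 1≤s ℓ≤s | inj₁ (_ , e) rewrite e | *-identityʳ s =
  ≤-reflexive (solve 1 (λ s → con 1 :+ s :+ con 4 := con 2 :+ (con 1 :+ s :+ con 2)) refl s)
  where open +-*-Solver
potential-next s (suc zero) 1≤s ℓ≤s | inj₂ (refl , e) rewrite e = ≤-refl
potential-next s (suc (suc k)) 1≤s ℓ≤s | inj₁ (_ , e) rewrite e | *-zeroʳ s =
  ≤-reflexive (cong (λ z → suc (suc (suc z))) (+-suc k (suc (suc k))))
potential-next s (suc (suc k)) 1≤s ℓ≤s | inj₂ (refl , e) rewrite e | *-zeroʳ k =
  ≤-reflexive (cong (λ z → suc (suc (suc z))) (+-suc k (suc (suc k))))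

-- Telescopes `potential-next` over `m` consecutive values; the final potential stays on the left
-- for the induction.
residue-count : ∀ s m u → 1 ≤ s →
  suc s * ∑ {m} (λ a → indicator (layer s (toℕ a + u) ≤ᵇ 1)) + potential s (layer s (m + u))
    ≤ 2 * m + potential s (layer s u)
residue-count s zero u 1≤s rewrite *-zeroʳ s = ≤-refl
residue-count s (suc m) u 1≤s = begin
  suc s * (g + ∑ {m} (λ a → indicator (layer s (suc (toℕ a) + u) ≤ᵇ 1))) + potential s (layer s (suc m + u))
    ≡⟨ cong₂ (λ z w → suc s * (g + z) + potential s (layer s w))
         (∑-cong {m} (λ a → cong (λ w → indicator (layer s w ≤ᵇ 1)) (sym (+-suc (toℕ a) u)))) (sym (+-suc m u)) ⟩
  suc s * (g + S) + Φ
    ≡⟨ solve 4 (λ r g S Φ → r :* (g :+ S) :+ Φ := r :* g :+ (r :* S :+ Φ)) refl (suc s) g S Φ ⟩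
  suc s * g + (suc s * S + Φ)
    ≤⟨ +-monoʳ-≤ (suc s * g) (residue-count s m (suc u) 1≤s) ⟩
  suc s * g + (2 * m + potential s (next s (layer s u)))
    ≡⟨ x∙yz≈y∙xz +-commutativeSemigroup (suc s * g) (2 * m) _ ⟩
  2 * m + (suc s * g + potential s (next s (layer s u)))
    ≤⟨ +-monoʳ-≤ (2 * m) (potential-next s (layer s u) 1≤s (layer≤ s u)) ⟩
  2 * m + (2 + potential s (layer s u))
    ≡⟨ solve 2 (λ m P → con 2 :* m :+ (con 2 :+ P) := con 2 :* (con 1 :+ m) :+ P) refl m (potential s (layer s u)) ⟩
  2 * suc m + potential s (layer s u) ∎
  where
  open ≤-Reasoning
  open +-*-Solver
  g = indicator (layer s u ≤ᵇ 1)
  S = ∑ {m} (λ a → indicator (layer s (toℕ a + suc u) ≤ᵇ 1))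
  Φ = potential s (layer s (m + suc u))

residue-count≤ : ∀ s m u → 1 ≤ s →
  suc s * ∑ {m} (λ a → indicator (layer s (toℕ a + u) ≤ᵇ 1)) ≤ 2 * (suc m + suc s)
residue-count≤ s m u 1≤s = begin
  suc s * S                          ≤⟨ m≤m+n _ _ ⟩
  suc s * S + potential s (layer s (m + u)) ≤⟨ residue-count s m u 1≤s ⟩
  2 * m + potential s (layer s u)    ≤⟨ +-mono-≤ (*-monoʳ-≤ 2 (n≤1+n m)) (potential≤ s _ 1≤s (layer≤ s u)) ⟩
  2 * suc m + (suc s + suc s)        ≡⟨ solve 2 (λ n r → con 2 :* n :+ (r :+ r) := con 2 :* (n :+ r)) refl (suc m) (suc s) ⟩
  2 * (suc m + suc s)                ∎
  where
  open ≤-Reasoning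
  open +-*-Solver
  S = ∑ {m} (λ a → indicator (layer s (toℕ a + u) ≤ᵇ 1))

-- The offset `v` collects the coordinates already split off by the recursion on the dimension.
layerCount : ℕ → ℕ → ℕ → ℕ → ℕ → ℕ
layerCount s d n k v = ∑ᵥ {d} {n} (λ x → indicator ((nz x ≡ᵇ k) ∧ (layer s (v + tot x) ≤ᵇ 1)))

layerCount-0 : ∀ s d m v → layerCount s d (suc m) 0 v ≡ indicator (layer s v ≤ᵇ 1)
layerCount-0 s zero m v = trans (+-identityʳ _) (cong (λ u → indicator (layer s u ≤ᵇ 1)) (+-identityʳ v))
layerCount-0 s (suc d) m v = begin
  layerCount s (suc d) (suc m) 0 v
    ≡⟨ ∑ᵥ-∷ {d} {suc m} (λ x → indicator ((nz x ≡ᵇ 0) ∧ (layer s (v + tot x) ≤ᵇ 1))) ⟩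
  layerCount s d (suc m) 0 v + ∑ {m} (λ _ → ∑ᵥ {d} {suc m} (λ _ → 0))
    ≡⟨ cong₂ _+_ (layerCount-0 s d m v) (trans (∑-cong {m} (λ _ → ∑ᵥ-zero d (suc m))) (∑-zero m)) ⟩
  indicator (layer s v ≤ᵇ 1) + 0
    ≡⟨ +-identityʳ _ ⟩
  indicator (layer s v ≤ᵇ 1) ∎
  where open ≡-Reasoning

layerCount-suc : ∀ s d m k v →
  layerCount s (suc d) (suc m) (suc k) v ≡
  layerCount s d (suc m) (suc k) v + ∑ {m} (λ a → layerCount s d (suc m) k (toℕ a + suc v))
layerCount-suc s d m k v =
  trans (∑ᵥ-∷ {d} {suc m} (λ x → indicator ((nz x ≡ᵇ suc k) ∧ (layer s (v + tot x) ≤ᵇ 1))))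
    (cong (layerCount s d (suc m) (suc k) v +_) (∑-cong {m} (λ a → ∑ᵥ-cong {d} {suc m} (λ x →
      cong (λ u → indicator ((nz x ≡ᵇ k) ∧ (layer s u ≤ᵇ 1))) (shift (toℕ a) (tot x))))))
  where
  shift : ∀ a t → v + (suc a + t) ≡ (a + suc v) + t
  shift = solve 3 (λ v a t → v :+ (con 1 :+ a :+ t) := (a :+ (con 1 :+ v)) :+ t) refl v
    where open +-*-Solver

-- Pascal's rule, by whether the first coordinate is zero. The last nonzero coordinate is counted by
-- residues, the `k` before it by at most n values each.
layerCount≤ : ∀ s d m k v → 1 ≤ s →
  suc s * layerCount s d (suc m) (suc k) v ≤ 2 * ((d C suc k) * ((suc m + suc s) * suc m ^ k))
layerCount≤ s zero m k v 1≤s rewrite *-zeroʳ s = z≤n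
layerCount≤ s (suc d) m k v 1≤s = begin
  suc s * layerCount s (suc d) n (suc k) v
    ≡⟨ trans (cong (suc s *_) (layerCount-suc s d m k v)) (*-distribˡ-+ (suc s) _ R) ⟩
  suc s * layerCount s d n (suc k) v + suc s * R
    ≤⟨ +-mono-≤ (layerCount≤ s d m k v 1≤s) (R≤ k) ⟩
  2 * ((d C suc k) * Q) + 2 * ((d C k) * Q)
    ≡⟨ solve 3 (λ a b Q → con 2 :* (a :* Q) :+ con 2 :* (b :* Q) := con 2 :* ((b :+ a) :* Q)) refl (d C suc k) (d C k) Q ⟩
  2 * ((d C k + d C suc k) * Q)
    ≡⟨ cong (λ c → 2 * (c * Q)) (nCk+nC[k+1]≡[n+1]C[k+1] d k) ⟩
  2 * ((suc d C suc k) * Q) ∎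
  where
  open ≤-Reasoning
  open +-*-Solver
  n = suc m
  Q = (n + suc s) * n ^ k
  R = ∑ {m} (λ a → layerCount s d n k (toℕ a + suc v))
  R≤ : ∀ k → suc s * ∑ {m} (λ a → layerCount s d n k (toℕ a + suc v)) ≤ 2 * ((d C k) * ((n + suc s) * n ^ k))
  R≤ zero = begin
    suc s * ∑ {m} (λ a → layerCount s d n 0 (toℕ a + suc v))
      ≡⟨ cong (suc s *_) (∑-cong {m} (λ a → layerCount-0 s d m (toℕ a + suc v))) ⟩
    suc s * ∑ {m} (λ a → indicator (layer s (toℕ a + suc v) ≤ᵇ 1))
      ≤⟨ residue-count≤ s m (suc v) 1≤s ⟩
    2 * (n + suc s)
      ≡⟨ cong (2 *_) (sym (trans (cong₂ _*_ (nC0≡1 d) (*-identityʳ (n + suc s))) (*-identityˡ _))) ⟩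
    2 * ((d C 0) * ((n + suc s) * 1)) ∎
  R≤ (suc k) = begin
    suc s * ∑ {m} (λ a → layerCount s d n (suc k) (toℕ a + suc v))
      ≡⟨ sym (∑-*ˡ {m} (suc s) (λ a → layerCount s d n (suc k) (toℕ a + suc v))) ⟩
    ∑ {m} (λ a → suc s * layerCount s d n (suc k) (toℕ a + suc v))
      ≤⟨ ∑-mono-≤ {m} (λ a → layerCount≤ s d m k (toℕ a + suc v) 1≤s) ⟩
    ∑ {m} (λ _ → 2 * ((d C suc k) * ((n + suc s) * n ^ k)))
      ≡⟨ ∑-const m _ ⟩
    m * (2 * ((d C suc k) * ((n + suc s) * n ^ k)))
      ≤⟨ *-monoˡ-≤ _ (n≤1+n m) ⟩
    n * (2 * ((d C suc k) * ((n + suc s) * n ^ k)))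
      ≡⟨ solve 4 (λ n c q b → n :* (con 2 :* (c :* (q :* b))) := con 2 :* (c :* (q :* (n :* b)))) refl n (d C suc k) (n + suc s) (n ^ k) ⟩
    2 * ((d C suc k) * ((n + suc s) * n ^ suc k)) ∎

rankedSum-one≡tot : ∀ {d n} (x : Vertex d n) → rankedSum (λ _ → 1) x ≡ tot x
rankedSum-one≡tot []          = refl
rankedSum-one≡tot (zero ∷ x)  = rankedSum-one≡tot x
rankedSum-one≡tot (suc a ∷ x) = cong₂ _+_ (+-identityʳ _) (rankedSum-one≡tot x)

stripCount-0 : ∀ d m → size (strip {d} {suc m} 0) ≤ 1
stripCount-0 d m = ≤-trans
  (∑ᵥ-mono-≤ {d} {suc m} {indicator ∘ strip 0} {λ x → indicator ((nz x ≡ᵇ 0) ∧ (layer 0 (0 + tot x) ≤ᵇ 1))} weaken)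
  (≤-reflexive (layerCount-0 0 d m 0))
  where
  layer-0 : ∀ u → layer 0 u ≡ 0
  layer-0 u = n≤0⇒n≡0 (layer≤ 0 u)
  weaken : ∀ x → indicator (strip 0 x) ≤ indicator ((nz x ≡ᵇ 0) ∧ (layer 0 (0 + tot x) ≤ᵇ 1))
  weaken x rewrite layer-0 (tot x) | layer-0 (rankedSum tailWeight x) with nz x ≡ᵇ 0 | evenB (tot x)
  ... | true  | true  = ≤-refl
  ... | true  | false = z≤n
  ... | false | _     = z≤n

-- The first nonzero coordinate does not enter the layer, so the parity condition halves its range.
stripCount-suc : ∀ d m s → evenB m ≡ true →
  2 * size (strip {suc d} {suc m} (suc s)) ≡
  2 * size (strip {d} {suc m} (suc s)) + m * layerCount (suc s) d (suc m) s 0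
stripCount-suc d m s even-m = begin
  2 * size (strip {suc d} {suc m} (suc s))
    ≡⟨ cong (2 *_) (∑ᵥ-∷ {d} {suc m} (indicator ∘ strip (suc s))) ⟩
  2 * (size (strip {d} {suc m} (suc s)) + ∑ {m} (λ a → ∑ᵥ {d} {suc m} (λ x → indicator (strip (suc s) (suc a ∷ x)))))
    ≡⟨ *-distribˡ-+ 2 (size (strip {d} {suc m} (suc s))) _ ⟩
  2 * size (strip {d} {suc m} (suc s)) + 2 * ∑ {m} (λ a → ∑ᵥ {d} {suc m} (λ x → indicator (strip (suc s) (suc a ∷ x))))
    ≡⟨ cong (λ z → 2 * size (strip {d} {suc m} (suc s)) + 2 * z) (trans (∑-∑ᵥ {d} {suc m} {m} _) (∑ᵥ-cong {d} {suc m} column)) ⟩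
  2 * size (strip {d} {suc m} (suc s)) + 2 * ∑ᵥ {d} {suc m} (λ x → half (suc (tot x)) * P x)
    ≡⟨ cong (2 * size (strip {d} {suc m} (suc s)) +_) (trans (∑ᵥ-*ˡ 2 (λ x → half (suc (tot x)) * P x)) (trans (∑ᵥ-cong {d} {suc m} double) (sym (∑ᵥ-*ˡ m P)))) ⟩
  2 * size (strip {d} {suc m} (suc s)) + m * layerCount (suc s) d (suc m) s 0 ∎
  where
  open ≡-Reasoning
  half : ℕ → ℕ
  half u = ∑ {m} (λ a → indicator (evenB (toℕ a + u)))
  P : Vertex d (suc m) → ℕ
  P x = indicator ((nz x ≡ᵇ s) ∧ (layer (suc s) (tot x) ≤ᵇ 1))
  ∑ᵥ-*ˡ : ∀ {d n} k (f : Vertex d n → ℕ) → k * ∑ᵥ f ≡ ∑ᵥ (λ x → k * f x)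
  ∑ᵥ-*ˡ {zero}  k f = trans (cong (k *_) (+-identityʳ (f []))) (sym (+-identityʳ _))
  ∑ᵥ-*ˡ {suc d} k f = trans (cong (k *_) (∑ᵥ-∷ f)) (trans (sym (∑-*ˡ k (λ a → ∑ᵥ (f ∘ (a ∷_)))))
    (trans (∑-cong (λ a → ∑ᵥ-*ˡ k (f ∘ (a ∷_)))) (sym (∑ᵥ-∷ (λ x → k * f x)))))
  column : ∀ x → ∑ {m} (λ a → indicator (strip (suc s) (suc a ∷ x))) ≡ half (suc (tot x)) * P x
  column x = trans (∑-cong {m} (λ a → trans
    (cong indicator (trans (cong (λ g → (nz x ≡ᵇ s) ∧ ((layer (suc s) g ≤ᵇ 1) ∧ evenB (suc (toℕ a) + tot x))) (rankedSum-one≡tot x))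
       (sym (∧-assoc (nz x ≡ᵇ s) (layer (suc s) (tot x) ≤ᵇ 1) _))))
    (trans (indicator-∧ ((nz x ≡ᵇ s) ∧ (layer (suc s) (tot x) ≤ᵇ 1)) (evenB (suc (toℕ a) + tot x)))
      (cong (λ u → indicator u * P x) (sym (evenB-+suc (toℕ a) (tot x)))))))
    (∑-*ʳ {m} (λ a → indicator (evenB (toℕ a + suc (tot x)))) (P x))
  double : ∀ x → 2 * (half (suc (tot x)) * P x) ≡ m * P x
  double x = trans (sym (*-assoc 2 (half (suc (tot x))) (P x))) (cong (_* P x) (parity-count m (suc (tot x)) even-m))

-- `m` counts the values of the first support coordinate. If it is the only one, nothing is left to
-- count by residues, but then r = 2 and the density 2 / r is trivial.
m*layerCount≤ : ∀ s d m →
  suc (suc s) * (m * layerCount (suc s) d (suc m) s 0) ≤ 2 * ((d C s) * ((suc m + suc (suc s)) * suc m ^ s))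
m*layerCount≤ zero d m rewrite layerCount-0 1 d m 0 | nC0≡1 d = *-monoʳ-≤ 2 (begin
  m * 1                     ≡⟨ *-identityʳ m ⟩
  m                         ≤⟨ ≤-trans (n≤1+n m) (m≤m+n (suc m) 2) ⟩
  suc m + 2                 ≡⟨ sym (trans (*-identityˡ ((suc m + 2) * 1)) (*-identityʳ (suc m + 2))) ⟩
  1 * ((suc m + 2) * 1)     ∎)
  where open ≤-Reasoning
m*layerCount≤ (suc k) d m = begin
  r * (m * H)                           ≡⟨ x∙yz≈y∙xz *-commutativeSemigroup r m H ⟩
  m * (r * H)                           ≤⟨ *-mono-≤ (n≤1+n m) (layerCount≤ (suc (suc k)) d m k 0 (s≤s z≤n)) ⟩
  n * (2 * ((d C suc k) * ((n + r) * n ^ k)))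
    ≡⟨ solve 4 (λ n c q b → n :* (con 2 :* (c :* (q :* b))) := con 2 :* (c :* (q :* (n :* b)))) refl n (d C suc k) (n + r) (n ^ k) ⟩
  2 * ((d C suc k) * ((n + r) * n ^ suc k)) ∎
  where
  open ≤-Reasoning
  open +-*-Solver
  n = suc m
  r = suc (suc (suc k))
  H = layerCount (suc (suc k)) d n (suc k) 0

-- Pascal's rule again. The 2 gained from the parity condition cancels the 2 lost to the pair of
-- layers.
stripCount≤ : ∀ d m s → evenB m ≡ true →
  suc s * (suc m * size (strip {d} {suc m} s)) ≤ (d C s) * ((suc m + suc s) * suc m ^ s)
stripCount≤ d m zero _ = begin
  1 * (suc m * size (strip {d} {suc m} 0)) ≡⟨ *-identityˡ _ ⟩
  suc m * size (strip {d} {suc m} 0)       ≤⟨ *-monoʳ-≤ (suc m) (stripCount-0 d m) ⟩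
  suc m * 1                                ≤⟨ *-monoˡ-≤ 1 (m≤m+n (suc m) 1) ⟩
  (suc m + 1) * 1                          ≡⟨ sym (*-identityˡ _) ⟩
  1 * ((suc m + 1) * 1)                    ≡⟨ cong (_* ((suc m + 1) * 1)) (sym (nC0≡1 d)) ⟩
  (d C 0) * ((suc m + 1) * 1)              ∎
  where open ≤-Reasoning
stripCount≤ zero m (suc s) _ rewrite *-zeroʳ m | *-zeroʳ s = z≤n
stripCount≤ (suc d) m (suc s) even-m = *-cancelˡ-≤ 2 (begin
  2 * (r * (n * size (strip {suc d} {n} (suc s))))
    ≡⟨ solve 3 (λ r n S → con 2 :* (r :* (n :* S)) := r :* (n :* (con 2 :* S))) refl r n (size (strip {suc d} {n} (suc s))) ⟩
  r * (n * (2 * size (strip {suc d} {n} (suc s))))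
    ≡⟨ cong (λ z → r * (n * z)) (stripCount-suc d m s even-m) ⟩
  r * (n * (2 * S + H))
    ≡⟨ solve 4 (λ r n S H → r :* (n :* (con 2 :* S :+ H)) := con 2 :* (r :* (n :* S)) :+ n :* (r :* H)) refl r n S H ⟩
  2 * (r * (n * S)) + n * (r * H)
    ≤⟨ +-mono-≤ (*-monoʳ-≤ 2 (stripCount≤ d m (suc s) even-m)) (*-monoʳ-≤ n (m*layerCount≤ s d m)) ⟩
  2 * ((d C suc s) * ((n + r) * n ^ suc s)) + n * (2 * ((d C s) * ((n + r) * n ^ s)))
    ≡⟨ solve 5 (λ n a b q c → con 2 :* (a :* (q :* (n :* c))) :+ n :* (con 2 :* (b :* (q :* c))) := con 2 :* ((b :+ a) :* (q :* (n :* c)))) refl n (d C suc s) (d C s) (n + r) (n ^ s) ⟩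
  2 * ((d C s + d C suc s) * ((n + r) * n ^ suc s))
    ≡⟨ cong (λ c → 2 * (c * ((n + r) * n ^ suc s))) (nCk+nC[k+1]≡[n+1]C[k+1] d s) ⟩
  2 * ((suc d C suc s) * ((n + r) * n ^ suc s)) ∎)
  where
  open ≤-Reasoning
  open +-*-Solver
  n = suc m
  r = suc (suc s)
  S = size (strip {d} {n} (suc s))
  H = m * layerCount (suc s) d n s 0

seed-size : ∀ d p s → evenB (suc p) ≡ true →
  suc s * suc (suc p) * size (seed {d} {suc (suc p)} s) ≤
  (d C s) * suc (suc p) ^ suc s + suc s * (3 ^ d + d C s) * suc (suc p) ^ s
seed-size d p s even-m = begin
  r * n * size (seed {d} {n} s)
    ≤⟨ *-monoʳ-≤ (r * n) (≤-trans
         (∑ᵥ-mono-≤ {d} {n} (λ x → indicator-∨ (suc (big x) ≤ᵇ s) (strip s x)))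
         (≤-reflexive (∑ᵥ-+ {d} {n} (λ x → indicator (suc (big x) ≤ᵇ s)) (indicator ∘ strip s)))) ⟩
  r * n * (L + U)
    ≡⟨ solve 4 (λ r n L U → r :* n :* (L :+ U) := r :* (n :* L) :+ r :* (n :* U)) refl r n L U ⟩
  r * (n * L) + r * (n * U)
    ≤⟨ +-mono-≤ (*-monoʳ-≤ r (lowCount≤ d p s)) (stripCount≤ d (suc p) s even-m) ⟩
  r * (3 ^ d * n ^ s) + (d C s) * ((n + r) * n ^ s)
    ≡⟨ solve 5 (λ r n a c b → r :* (a :* b) :+ c :* ((n :+ r) :* b) := c :* (n :* b) :+ r :* (a :+ c) :* b) refl r n (3 ^ d) (d C s) (n ^ s) ⟩
  (d C s) * n ^ suc s + r * (3 ^ d + d C s) * n ^ s ∎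
  where
  open ≤-Reasoning
  open +-*-Solver
  n = suc (suc p)
  r = suc s
  L = lowCount d n s
  U = size (strip {d} {n} s)

-- Persistence and periodicity of runs.

AllActive : ∀ {d n} → Config d n → Set
AllActive c = ∀ x → c x ≡ true

-- Configurations are functions compared pointwise, so the dynamics has to respect `≗`.
step-cong : ∀ {d n} r {c c′ : Config d n} → c ≗ c′ → step r c ≗ step r c′
step-cong r e x = cong (r ≤ᵇ_) (∑ᵥ-cong (λ y → cong (λ b → indicator (adj x y ∧ b)) (e y)))

run-cong : ∀ {d n} r t {c c′ : Config d n} → c ≗ c′ → run r t c ≗ run r t c′
run-cong r zero    e = e
run-cong r (suc t) e = step-cong r (run-cong r t e)

run-+ : ∀ {d n} r a b (c : Config d n) → run r (a + b) c ≡ run r a (run r b c)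
run-+ r zero    b c = refl
run-+ r (suc a) b c = cong (step r) (run-+ r a b c)

run-periodic : ∀ {d n} r q k {c : Config d n} → run r q c ≗ c → run r (k * q) c ≗ c
run-periodic r q zero        per x = refl
run-periodic r q (suc k) {c} per x = begin
  run r (q + k * q) c x       ≡⟨ cong (λ c′ → c′ x) (run-+ r q (k * q) c) ⟩
  run r q (run r (k * q) c) x ≡⟨ run-cong r q (run-periodic r q k per) x ⟩
  run r q c x                 ≡⟨ per x ⟩
  c x                         ∎
  where open ≡-Reasoning

module _ {m} (2≤m : 2 ≤ m) {d r} (r≤d : r ≤ d) where

  -- Each of the `d` directions supplies an active neighbour, and `r ≤ d`.
  step-AllActive : {c : Config d (suc m)} → AllActive c → AllActive (step r c)
  step-AllActive {c} full x = step-active 2≤m c x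
    (≤-trans r≤d (subst (_≤ ∑ (contribution c x)) (trans (∑-const d 1) (*-identityʳ d))
      (∑-mono-≤ (λ i → contribution-up c x i (full _)))))

  run-AllActive : ∀ t {c : Config d (suc m)} → AllActive c → AllActive (run r t c)
  run-AllActive zero    full = full
  run-AllActive (suc t) full = step-AllActive (run-AllActive t full)

  run-AllActive-≤ : ∀ {t u} → t ≤ u → (c : Config d (suc m)) → AllActive (run r t c) → AllActive (run r u c)
  run-AllActive-≤ {t} {u} t≤u c full = subst AllActive
    (trans (sym (run-+ r (u ∸ t) t c)) (cong (λ v → run r v c) (m∸n+n≡m t≤u))) (run-AllActive (u ∸ t) full)

-- Finite encoding of configurations, decidability and the minimum.

boolToFin : Bool → Fin 2
boolToFin true  = zero
boolToFin false = suc zero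

finToBool : Fin 2 → Bool
finToBool zero    = true
finToBool (suc _) = false

finToBool-boolToFin : ∀ b → finToBool (boolToFin b) ≡ b
finToBool-boolToFin true  = refl
finToBool-boolToFin false = refl

module _ {d n : ℕ} where

  vertexAt : Fin (n ^ d) → Vertex d n
  vertexAt k = Vec.tabulate (finToFun k)

  vertexAt-funToFin : ∀ x → vertexAt (funToFin (lookup x)) ≡ x
  vertexAt-funToFin x = trans (Vec.tabulate-cong (finToFun-funToFin (lookup x))) (Vec.tabulate∘lookup x)

  configAt : Fin (2 ^ (n ^ d)) → Config d n
  configAt k x = finToBool (finToFun k (funToFin (lookup x)))

  index : Config d n → Fin (2 ^ (n ^ d))
  index c = funToFin (λ k → boolToFin (c (vertexAt k)))

  configAt-index : ∀ c → configAt (index c) ≗ c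
  configAt-index c x = begin
    configAt (index c) x
      ≡⟨ cong finToBool (finToFun-funToFin (λ k → boolToFin (c (vertexAt k))) (funToFin (lookup x))) ⟩
    finToBool (boolToFin (c (vertexAt (funToFin (lookup x)))))
      ≡⟨ finToBool-boolToFin _ ⟩
    c (vertexAt (funToFin (lookup x)))
      ≡⟨ cong c (vertexAt-funToFin x) ⟩
    c x ∎
    where open ≡-Reasoning

  index-injective : ∀ {c c′} → index c ≡ index c′ → c ≗ c′
  index-injective {c} {c′} e x =
    trans (sym (configAt-index c x)) (trans (cong (λ k → configAt k x) e) (configAt-index c′ x))

  allActive? : (c : Config d n) → Dec (AllActive c)
  allActive? c = map′ (λ h x → subst (λ y → c y ≡ true) (vertexAt-funToFin x) (h (funToFin (lookup x))))
    (λ h k → h (vertexAt k)) (all? (λ k → c (vertexAt k) Bool.≟ true))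

module _ {m} (2≤m : 2 ≤ m) {d r} (r≤d : r ≤ d) where

  private
    N : ℕ
    N = 2 ^ (suc m ^ d)

  -- Two of the first N + 1 configurations coincide, so from then on the run is periodic.
  dynamo⇒AllActive-N : ∀ c → IsDynamo d (suc m) r c → AllActive (run r N c)
  dynamo⇒AllActive-N c (T , full) with pigeonhole (n<1+n N) (λ k → index (run r (toℕ k) c))
  ... | i , j , i<j , e = run-AllActive-≤ 2≤m r≤d (<⇒≤ (≤-trans i<j (≤-pred (toℕ<n j)))) c full-i
    where
    q : ℕ
    q = toℕ j ∸ toℕ i
    period : run r q (run r (toℕ i) c) ≗ run r (toℕ i) c
    period x = begin
      run r q (run r (toℕ i) c) x ≡⟨ cong (λ c′ → c′ x) (sym (run-+ r q (toℕ i) c)) ⟩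
      run r (q + toℕ i) c x       ≡⟨ cong (λ t → run r t c x) (m∸n+n≡m (<⇒≤ i<j)) ⟩
      run r (toℕ j) c x           ≡⟨ sym (index-injective e x) ⟩
      run r (toℕ i) c x           ∎
      where open ≡-Reasoning
    -- The period `q` is positive, so going round it `T` times reaches a round from `T` on.
    T≤ : T ≤ T * q + toℕ i
    T≤ = ≤-trans (≤-trans (≤-reflexive (sym (*-identityʳ T))) (*-monoʳ-≤ T (m<n⇒0<n∸m i<j))) (m≤m+n _ _)
    full-i : AllActive (run r (toℕ i) c)
    full-i x = begin
      run r (toℕ i) c x                 ≡⟨ sym (run-periodic r q T period x) ⟩
      run r (T * q) (run r (toℕ i) c) x ≡⟨ cong (λ c′ → c′ x) (sym (run-+ r (T * q) (toℕ i) c)) ⟩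
      run r (T * q + toℕ i) c x         ≡⟨ full _ T≤ x ⟩
      true                              ∎
      where open ≡-Reasoning

  -- A dynamo is full in round `N`, and fullness persists, so testing that round decides.
  dynamo? : ∀ c → Dec (IsDynamo d (suc m) r c)
  dynamo? c = map′ (λ full → N , λ t N≤t → run-AllActive-≤ 2≤m r≤d N≤t c full) (dynamo⇒AllActive-N c)
    (allActive? (run r N c))

  DynamoOfSize : ℕ → Set
  DynamoOfSize k = Σ (Config d (suc m)) λ c → IsDynamo d (suc m) r c × size c ≡ k

  dynamoOfSize? : ∀ k → Dec (DynamoOfSize k)
  dynamoOfSize? k = map′ (λ (i , p) → configAt {d} {suc m} i , p) to-index
    (any? (λ i → dynamo? (configAt {d} {suc m} i) ×-dec (size (configAt {d} {suc m} i) ℕ.≟ k)))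
    where
    to-index : DynamoOfSize k → ∃ λ i → IsDynamo d (suc m) r (configAt i) × size (configAt {d} {suc m} i) ≡ k
    to-index (c , (T , full) , e) = index c ,
      (T , λ t T≤t x → trans (run-cong r t (configAt-index c) x) (full t T≤t x)) ,
      trans (∑ᵥ-cong {d} {suc m} (λ x → cong indicator (configAt-index c x))) e

least : ∀ {P : ℕ → Set} → (∀ k → Dec (P k)) → ∀ M → P M → ∃ λ k → P k × k ≤ M × (∀ j → P j → k ≤ j)
least P? zero    pM = zero , pM , z≤n , λ _ _ → z≤n
least P? (suc M) pM with P? 0
... | yes p0 = 0 , p0 , z≤n , λ _ _ → z≤n
... | no ¬p0 =
  let k , pk , k≤M , min = least (P? ∘ suc) M pM
  in suc k , pk , s≤s k≤M , λ { zero p → ⊥-elim (¬p0 p) ; (suc j) p → s≤s (min j p) }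

minDynamoSize : ∀ {m} → 2 ≤ m → ∀ {d r} → r ≤ d → (c : Config d (suc m)) → IsDynamo d (suc m) r c →
  ∃ λ k → IsMinDynamoSize d (suc m) r k × k ≤ size c
minDynamoSize 2≤m r≤d c dyn =
  let k , pk , k≤ , min = least (dynamoOfSize? 2≤m r≤d) (size c) (c , dyn , refl)
  in k , (pk , λ c′ dyn′ → min (size c′) (c′ , dyn′ , refl)) , k≤

-- The upper bound for odd n.

evenB-2* : ∀ k → evenB (2 * k) ≡ true
evenB-2* zero    = refl
evenB-2* (suc k) = trans (cong evenB (*-suc 2 k)) (trans (not-involutive (evenB (2 * k))) (evenB-2* k))

-- Multiplying by r n clears the fraction and turns n^(r-2) into a natural power, also for r = 1.
theorem6 : (d r : ℕ) → 1 ≤ d → 1 ≤ r → r ≤ d →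
    Σ ℕ (λ K → 1 ≤ K × Σ ℕ (λ n₀ → (n : ℕ) → Odd n → n₀ ≤ n →
    Σ ℕ (λ m → IsMinDynamoSize d n r m ×
    r * n * m ≤ (d C (r ∸ 1)) * n ^ r + r * K * n ^ (r ∸ 1))))
-- `3 ^ d` pays for the low vertices and `d C s` for the rounding in the residue count. From n = 3
-- on, a coordinate and its two cyclic neighbours are distinct.
theorem6 d (suc s) _ _ s<d = 3 ^ d + d C s , ≤-trans (m^n>0 3 d) (m≤m+n _ _) , 3 , bound
  where
  bound : (n : ℕ) → Odd n → 3 ≤ n → Σ ℕ (λ m → IsMinDynamoSize d n (suc s) m ×
    suc s * n * m ≤ (d C s) * n ^ suc s + suc s * (3 ^ d + d C s) * n ^ s)
  bound (suc (suc p)) (k , e) (s≤s (s≤s 1≤p)) =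
    let even-m = trans (cong evenB (suc-injective e)) (evenB-2* k)
        k , isMin , k≤ = minDynamoSize (s≤s 1≤p) s<d (seed s) (Dynamics.seed-dynamo p 1≤p even-m d s s<d)
    in k , isMin , ≤-trans (*-monoʳ-≤ (suc s * suc (suc p)) k≤) (seed-size d p s even-m)
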